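{- Let $h=(h(n))_{n\ge 1}$ be a sequence of positive real numbers with $h(1)=1$, and let $n\ge 2$. Then the polynomial $P_n^h(z)$ has a unique zero of maximal modulus among its complex zeros. This zero is real, negative, and simple.
   Context: For a sequence $h=(h(n))_{n\ge1}$ of positive real numbers with $h(1)=1$, the generalized D'Arcais polynomials $P_n^h(z)$ are defined recursively by $P_0^h(z)=1$ and, for $n\ge 1$, \[ P_n^h(z)=\frac{z}{h(n)}\sum_{k=1}^n \sigma(k)\,P_{n-k}^h(z), \] where $\sigma(k)=\sum_{d\mid k} d$ is the sum of the positive divisors of $k$. "Unique zero of maximal modulus" means that there is a zero $\alpha$ such that every zero $\beta\ne\alpha$ satisfies $|\beta|<|\alpha|$; "simple" means multiplicity one. -}

module Defs where

open import Algebra.Bundles using (CommutativeRing; RawRing; RawSemiring)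
import Algebra.Definitions.RawSemiring as RawSemiringDefinitions
import Algebra.Solver.Ring.NaturalCoefficients.Default as SemiringSolver
open import Data.List.Base using (List; []; _∷_; map; filter; applyUpTo; foldr)
open import Data.Nat.Base as ℕ using (ℕ; zero; suc; _∸_)
import Data.Nat.Properties as ℕ
open import Data.Nat.Divisibility using (_∣?_)
open import Data.Nat.ListAction using (sum)
open import Data.Product.Base using (_×_; _,_; ∃; proj₁; proj₂)
open import Data.Sum.Base using (inj₁; inj₂; [_,_]′)
open import Function.Base using (_∘_)
open import Level using (Level; _⊔_) renaming (suc to lsuc)
open import Relation.Binary.Core using (Rel)
open import Relation.Binary.Definitions using (tri<; tri≈; tri>)
open import Relation.Binary.Structures using (IsStrictTotalOrder)
import Relation.Binary.Construct.StrictToNonStrict as StrictToNonStrict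
open import Relation.Binary.PropositionalEquality.Core as ≡ using (_≡_; cong; cong₂)
open import Relation.Nullary using (¬_)
open import Relation.Nullary.Negation using (contradiction)
open import Relation.Unary using (Pred; _∈_; Satisfiable)

-- The classical axioms of the real numbers. They determine the structure up to
-- isomorphism, so a theorem about ℝ is stated for an arbitrary model of them.
record CompleteOrderedField (ℓ : Level) : Set (lsuc ℓ) where
  field
    commutativeRing : CommutativeRing ℓ ℓ

  open CommutativeRing commutativeRing public

  infix 4 _<_
  infix 9 _⁻¹

  field
    _<_                : Rel Carrier ℓ
    isStrictTotalOrder : IsStrictTotalOrder _≈_ _<_
    0<1                : 0# < 1#
    +-monoʳ-<          : ∀ x {y z} → y < z → x + y < x + z
    *-pos              : ∀ {x y} → 0# < x → 0# < y → 0# < x * y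

    -- Total for convenience; 0# ⁻¹ is unconstrained.
    _⁻¹                : Carrier → Carrier
    *-inverseʳ         : ∀ {x} → ¬ x ≈ 0# → x * x ⁻¹ ≈ 1#

  open StrictToNonStrict _≈_ _<_ public using (_≤_)

  IsUpperBound : Pred Carrier ℓ → Pred Carrier ℓ
  IsUpperBound S u = ∀ {x} → x ∈ S → x ≤ u

  IsSupremum : Pred Carrier ℓ → Pred Carrier ℓ
  IsSupremum S s = IsUpperBound S s × (∀ {u} → IsUpperBound S u → s ≤ u)

  field
    supremum : ∀ (S : Pred Carrier ℓ) →
               Satisfiable S → Satisfiable (IsUpperBound S) → ∃ (IsSupremum S)

module SquareRoot {ℓ} (ℝ : CompleteOrderedField ℓ) where

  open CompleteOrderedField ℝ
  open IsStrictTotalOrder isStrictTotalOrder public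
    using (compare) renaming (trans to <-trans; irrefl to <-irrefl; asym to <-asym
      ; <-respʳ-≈ to <-respʳ; <-respˡ-≈ to <-respˡ)
  open SemiringSolver commutativeSemiring using (solve; _:+_; _:*_; _:=_; con)

  private
    variable
      u v x y z : Carrier

    ≤-<-trans : x ≤ y → y < z → x < z
    ≤-<-trans (inj₁ p) q = <-trans p q
    ≤-<-trans (inj₂ p) q = <-respˡ (sym p) q

    <-≤-trans : x < y → y ≤ z → x < z
    <-≤-trans p (inj₁ q) = <-trans p q
    <-≤-trans p (inj₂ q) = <-respʳ q p

    ≮⇒≥ : ¬ x < y → y ≤ x
    ≮⇒≥ {x} {y} ¬p with compare x y
    ... | tri< p _ _ = contradiction p ¬p
    ... | tri≈ _ p _ = inj₂ (sym p)
    ... | tri> _ _ p = inj₁ p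

    +-cancelˡ-< : ∀ x → x + y < x + z → y < z
    +-cancelˡ-< x p = <-respˡ (shift _) (<-respʳ (shift _) (+-monoʳ-< (- x) p))
      where
      shift : ∀ w → - x + (x + w) ≈ w
      shift w = trans (sym (+-assoc _ _ _)) (trans (+-congʳ (-‿inverseˡ x)) (+-identityˡ w))

    difference : x < y → ∃ λ d → 0# < d × x + d ≈ y
    difference {x} {y} p = y + - x
      , +-cancelˡ-< x (<-respˡ (sym (+-identityʳ x)) (<-respʳ (sym e) p)) , e
      where
      e : x + (y + - x) ≈ y
      e = trans (+-congˡ (+-comm y (- x))) (trans (sym (+-assoc _ _ _))
            (trans (+-congʳ (-‿inverseʳ x)) (+-identityˡ y)))

    x<x+d : 0# < v → x < x + v
    x<x+d p = <-respˡ (+-identityʳ _) (+-monoʳ-< _ p)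

    rearrangement : x < y → u < v → x * v + y * u < x * u + y * v
    rearrangement {x} {y} {u} {v} p q with difference p | difference q
    ... | d , 0<d , e | f , 0<f , e′ = <-respˡ (+-cong (*-congˡ e′) (*-congʳ e))
      (<-respʳ (trans (solve 4 (λ x d u f → (x :* (u :+ f) :+ (x :+ d) :* u) :+ d :* f
                                      := x :* u :+ (x :+ d) :* (u :+ f)) refl x d u f)
                      (+-congˡ (*-cong e e′)))
               (x<x+d (*-pos 0<d 0<f)))

    *-monoˡ-< : 0# < z → x < y → x * z < y * z
    *-monoˡ-< {z} {x} {y} 0<z p with difference p
    ... | d , 0<d , e =
      <-respʳ (trans (sym (distribʳ z x d)) (*-congʳ e)) (x<x+d (*-pos 0<d 0<z))

    *-cancelˡ-< : 0# < z → x * z < y * z → x < y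
    *-cancelˡ-< {z} {x} {y} 0<z p with compare x y
    ... | tri< q _ _ = q
    ... | tri≈ _ q _ = contradiction p (<-irrefl (*-congʳ q))
    ... | tri> _ _ q = contradiction p (<-asym (*-monoˡ-< 0<z q))

    +-pos : 0# < x → 0# ≤ y → 0# < x + y
    +-pos p (inj₁ q) = <-trans p (x<x+d q)
    +-pos p (inj₂ q) = <-respʳ (trans (sym (+-identityʳ _)) (+-congˡ q)) p

    square-mono-< : 0# ≤ x → x < y → x * x < y * y
    square-mono-< (inj₁ 0<x) p = <-trans (*-monoˡ-< 0<x p)
      (<-respˡ (*-comm _ _) (*-monoˡ-< (<-trans 0<x p) p))
    square-mono-< (inj₂ 0≈x) p = <-respˡ
      (trans (sym (zeroˡ 0#)) (*-cong 0≈x 0≈x)) (*-pos 0<y 0<y)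
      where 0<y = <-respˡ (sym 0≈x) p

    divide : 0# < y → ∃ λ q → q * y ≈ x
    divide {y} {x} 0<y = x * y ⁻¹ , trans (*-assoc _ _ _)
      (trans (*-congˡ (trans (*-comm _ _) (*-inverseʳ (λ e → <-irrefl (sym e) 0<y))))
             (*-identityʳ x))

  0≤x*x : ∀ x → 0# ≤ x * x
  0≤x*x x with compare 0# x
  ... | tri< p _ _ = inj₁ (*-pos p p)
  ... | tri≈ _ p _ = inj₂ (trans (sym (zeroˡ 0#)) (*-cong p p))
  ... | tri> _ _ p with difference p
  ...   | d , 0<d , e = inj₁ (<-respʳ d²≈x² (*-pos 0<d 0<d))
    where
    d²≈x² : d * d ≈ x * x
    d²≈x² = trans (sym (+-identityʳ _)) (trans (+-congˡ (sym (trans (*-congˡ e) (zeroʳ x))))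
      (trans (solve 2 (λ x d → d :* d :+ x :* (x :+ d) := x :* x :+ (x :+ d) :* d) refl x d)
      (trans (+-congˡ (trans (*-congʳ e) (zeroˡ d))) (+-identityʳ _))))

  0≤x+y : 0# ≤ x → 0# ≤ y → 0# ≤ x + y
  0≤x+y (inj₁ p) q = inj₁ (+-pos p q)
  0≤x+y (inj₂ p) (inj₁ q) = inj₁ (<-respʳ (+-comm _ _) (+-pos q (inj₂ p)))
  0≤x+y (inj₂ p) (inj₂ q) = inj₂ (trans (sym (+-identityˡ 0#)) (+-cong p q))

  private
    square-* : ∀ t m → (t * m) * (t * m) ≈ (t * t) * (m * m)
    square-* = solve 2 (λ t m → (t :* m) :* (t :* m) := (t :* t) :* (m :* m)) refl

    square-+ : ∀ x y → (x + y) * (x + y) ≈ (x * y + x * y) + (x * x + y * y)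
    square-+ = solve 2 (λ x y → (x :+ y) :* (x :+ y)
                              := (x :* y :+ x :* y) :+ (x :* x :+ y :* y)) refl

    square-÷ : x * y ≈ z → (x * x) * (y * y) ≈ z * z
    square-÷ e = trans (sym (square-* _ _)) (*-cong e e)

    numerator² : ∀ a s c → (s * c + a) * (s * c + a)
               ≈ (s * c * a + s * c * a) + ((s * s) * (c * c) + a * a)
    numerator² a s c = trans (square-+ (s * c) a) (+-congˡ (+-congʳ (square-* s c)))

    denominator² : ∀ a s c → (s * c * a + s * c * a) + ((s * s) * a + a * (c * c))
                 ≈ a * ((s + c) * (s + c))
    denominator² = solve 3 (λ a s c →
      (s :* c :* a :+ s :* c :* a) :+ ((s :* s) :* a :+ a :* (c :* c))
      := a :* ((s :+ c) :* (s :+ c))) refl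

    -- With a < c², take t = (s c + a) / (s + c).
    improve-lower : ∀ {a s c} → 0# ≤ s → 0# < c → a < c * c → s * s < a →
                    ∃ λ t → s < t × t * t < a
    improve-lower {a} {s} {c} 0≤s 0<c a<c² s²<a = t , s<t , t²<a
      where
      0<m : 0# < s + c
      0<m = <-respʳ (+-comm c s) (+-pos 0<c 0≤s)
      t = proj₁ (divide {s + c} {s * c + a} 0<m)
      tm≈ : t * (s + c) ≈ s * c + a
      tm≈ = proj₂ (divide 0<m)
      s<t : s < t
      s<t = *-cancelˡ-< 0<m (<-respʳ (sym tm≈) (<-respˡ
        (trans (+-comm (s * c) (s * s)) (sym (distribˡ s s c))) (+-monoʳ-< (s * c) s²<a)))
      t²<a : t * t < a
      t²<a = *-cancelˡ-< (*-pos 0<m 0<m) (<-respˡ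
        (trans (sym (numerator² a s c)) (sym (square-÷ tm≈)))
        (<-respʳ (denominator² a s c) (+-monoʳ-< _ (rearrangement s²<a a<c²))))

    -- Here t = (s² + a) / (2 s).
    improve-upper : ∀ {a s} → 0# < s → 0# ≤ a → a < s * s →
                    ∃ λ t → 0# < t × t < s × a < t * t
    improve-upper {a} {s} 0<s 0≤a a<s² = t , 0<t , t<s , a<t²
      where
      0<m : 0# < s + s
      0<m = +-pos 0<s (inj₁ 0<s)
      t = proj₁ (divide {s + s} {s * s + a} 0<m)
      tm≈ : t * (s + s) ≈ s * s + a
      tm≈ = proj₂ (divide 0<m)
      0<t : 0# < t
      0<t = *-cancelˡ-< 0<m (<-respˡ (sym (zeroˡ _)) (<-respʳ (sym tm≈)
              (+-pos (*-pos 0<s 0<s) 0≤a)))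
      t<s : t < s
      t<s = *-cancelˡ-< 0<m (<-respˡ (sym tm≈)
              (<-respʳ (sym (distribˡ s s s)) (+-monoʳ-< (s * s) a<s²)))
      a<t² : a < t * t
      a<t² = *-cancelˡ-< (*-pos 0<m 0<m) (<-respʳ
        (trans (sym (numerator² a s s)) (sym (square-÷ tm≈)))
        (<-respˡ (denominator² a s s) (+-monoʳ-< _
          (<-respˡ (+-comm _ _)
            (<-respʳ (+-comm _ _) (rearrangement a<s² a<s²))))))

  module _ (a : Carrier) (0≤a : 0# ≤ a) where

    private
      Below : Pred Carrier ℓ
      Below r = r * r ≤ a

      0∈Below : 0# ∈ Below
      0∈Below = [ inj₁ ∘ <-respˡ (sym (zeroˡ 0#)) , inj₂ ∘ trans (zeroˡ 0#) ]′ 0≤a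

      0<a+1 : 0# < a + 1#
      0<a+1 = <-respʳ (+-comm _ _) (+-pos 0<1 0≤a)

      a<[a+1]² : a < (a + 1#) * (a + 1#)
      a<[a+1]² = <-respʳ
        (solve 1 (λ a → a :+ (con 1 :+ (a :* a :+ a)) := (a :+ con 1) :* (a :+ con 1)) refl a)
        (x<x+d (+-pos 0<1 (0≤x+y (0≤x*x a) 0≤a)))

      bound : 0# ≤ u → a ≤ u * u → IsUpperBound Below u
      bound 0≤u a≤u² r²≤a = ≮⇒≥ λ u<r →
        <-irrefl refl (≤-<-trans a≤u² (<-≤-trans (square-mono-< 0≤u u<r) r²≤a))

      root : ∃ (IsSupremum Below)
      root = supremum Below (0# , 0∈Below)
               (a + 1# , bound (inj₁ 0<a+1) (inj₁ a<[a+1]²))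

      supremum⇒root : ∀ {s} → IsSupremum Below s → s * s ≈ a
      supremum⇒root {s} (s-bound , s-least) with compare (s * s) a
      ... | tri≈ _ e _ = e
      ... | tri< s²<a _ _ with improve-lower (s-bound 0∈Below) 0<a+1 a<[a+1]² s²<a
      ...   | t , s<t , t²<a = contradiction (<-≤-trans s<t (s-bound (inj₁ t²<a))) (<-irrefl refl)
      supremum⇒root {s} (s-bound , s-least) | tri> _ _ a<s² with s-bound 0∈Below
      ... | inj₂ e = contradiction (≤-<-trans 0≤a a<s²)
                       (<-irrefl (trans (sym (zeroˡ 0#)) (*-cong e e)))
      ... | inj₁ 0<s with improve-upper 0<s 0≤a a<s²
      ...   | t , 0<t , t<s , a<t² = contradiction
                (≤-<-trans (s-least (bound (inj₁ 0<t) (inj₁ a<t²))) t<s) (<-irrefl refl)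

    sqrt : Carrier
    sqrt = proj₁ root

    0≤sqrt : 0# ≤ sqrt
    0≤sqrt = proj₁ (proj₂ root) 0∈Below

    sqrt*sqrt≈ : sqrt * sqrt ≈ a
    sqrt*sqrt≈ = supremum⇒root (proj₂ root)

module ComplexNumbers {ℓ} (ℝ : CompleteOrderedField ℓ) where

  private module ℝ = CompleteOrderedField ℝ
  open ℝ using () renaming (Carrier to R)
  open SquareRoot ℝ using (sqrt; 0≤x*x; 0≤x+y)

  record ℂ : Set ℓ where
    constructor _+i_
    field
      re im : R

  open ℂ public

  ofReal : R → ℂ
  ofReal x = x +i ℝ.0#

  ℂ-rawRing : RawRing ℓ ℓ
  ℂ-rawRing = record
    { Carrier = ℂ
    ; _≈_     = λ z w → re z ℝ.≈ re w × im z ℝ.≈ im w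
    ; _+_     = λ z w → (re z ℝ.+ re w) +i (im z ℝ.+ im w)
    ; _*_     = λ z w → (re z ℝ.* re w ℝ.- im z ℝ.* im w)
                        +i (re z ℝ.* im w ℝ.+ im z ℝ.* re w)
    ; -_      = λ z → (ℝ.- re z) +i (ℝ.- im z)
    ; 0#      = ofReal ℝ.0#
    ; 1#      = ofReal ℝ.1#
    }

  modulus : ℂ → R
  modulus z = sqrt (re z ℝ.* re z ℝ.+ im z ℝ.* im z) (0≤x+y (0≤x*x (re z)) (0≤x*x (im z)))

-- A polynomial is its list of coefficients, constant term first; trailing zeros
-- are allowed, so equality compares coefficients rather than lists.
module Polynomials {a ℓ} (R : RawRing a ℓ) where

  private module R = RawRing R

  Poly : Set a
  Poly = List R.Carrier

  coefficient : Poly → ℕ → R.Carrier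
  coefficient []      _       = R.0#
  coefficient (c ∷ p) zero    = c
  coefficient (c ∷ p) (suc i) = coefficient p i

  constant : R.Carrier → Poly
  constant c = c ∷ []

  X : Poly
  X = R.0# ∷ R.1# ∷ []

  infixl 6 _⊕_
  infixl 7 _⊗_

  _⊕_ : Poly → Poly → Poly
  []      ⊕ q       = q
  (c ∷ p) ⊕ []      = c ∷ p
  (c ∷ p) ⊕ (d ∷ q) = (c R.+ d) ∷ (p ⊕ q)

  _⊗_ : Poly → Poly → Poly
  []      ⊗ q = []
  (c ∷ p) ⊗ q = map (c R.*_) q ⊕ (R.0# ∷ (p ⊗ q))

  evaluate : Poly → R.Carrier → R.Carrier
  evaluate []      z = R.0#
  evaluate (c ∷ p) z = c R.+ z R.* evaluate p z

  polyRawSemiring : RawSemiring a ℓ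
  polyRawSemiring = record
    { Carrier = Poly
    ; _≈_     = λ p q → ∀ i → coefficient p i R.≈ coefficient q i
    ; _+_     = _⊕_
    ; _*_     = _⊗_
    ; 0#      = []
    ; 1#      = constant R.1#
    }

  open RawSemiringDefinitions polyRawSemiring public
    using (_∣_; _∤_; _^_) renaming (_×_ to _·_)

  IsZero : Poly → R.Carrier → Set ℓ
  IsZero p z = evaluate p z R.≈ R.0#

  HasMultiplicity : Poly → R.Carrier → ℕ → Set (a ⊔ ℓ)
  HasMultiplicity p z m = (X-z ^ m ∣ p) × (X-z ^ suc m ∤ p)
    where
    X-z : Poly
    X-z = X ⊕ constant (R.- z)

  IsSimpleZero : Poly → R.Carrier → Set (a ⊔ ℓ)
  IsSimpleZero p z = HasMultiplicity p z 1

σ : ℕ → ℕ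
σ k = sum (filter (_∣? k) (applyUpTo suc k))

module D'Arcais {ℓ} (ℝ : CompleteOrderedField ℓ) where

  open CompleteOrderedField ℝ using (Carrier; rawRing; _⁻¹)
  open Polynomials rawRing

  mutual
    -- The value h 0 is never used.
    P : (ℕ → Carrier) → ℕ → Poly
    P h zero    = constant (RawRing.1# rawRing)
    P h (suc n) = (X ⊗ constant (h (suc n) ⁻¹)) ⊗ convolution h 0 (suc n)

    -- convolution h j n = Σ_{k=1}^n σ(j+k) P_{n-k}; the shift j makes the
    -- recursion structural.
    convolution : (ℕ → Carrier) → ℕ → ℕ → Poly
    convolution h j zero    = []
    convolution h j (suc n) = σ (suc j) · P h n ⊕ convolution h (suc j) n

  Σ₁ : ℕ → (ℕ → Poly) → Poly
  Σ₁ n f = foldr _⊕_ [] (applyUpTo (f ∘ suc) n)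

  P-recurrence : ∀ h n → P h (suc n) ≡
    (X ⊗ constant (h (suc n) ⁻¹)) ⊗ Σ₁ (suc n) (λ k → σ k · P h (suc n ∸ k))
  P-recurrence h n = cong (λ p → (X ⊗ constant (h (suc n) ⁻¹)) ⊗ p) (unfold 0 (suc n))
    where
    Σ₁-cong : ∀ n {f g : ℕ → Poly} → (∀ k → f k ≡ g k) → Σ₁ n f ≡ Σ₁ n g
    Σ₁-cong zero    e = ≡.refl
    Σ₁-cong (suc n) e = cong₂ _⊕_ (e 1) (Σ₁-cong n (e ∘ suc))

    unfold : ∀ j n → convolution h j n ≡ Σ₁ n (λ k → σ (j ℕ.+ k) · P h (n ∸ k))
    unfold j zero    = ≡.refl
    unfold j (suc n) = cong₂ _⊕_
      (cong (λ i → σ i · P h n) (≡.sym (ℕ.+-comm j 1)))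
      (≡.trans (unfold (suc j) n)
        (Σ₁-cong n (λ k → cong (λ i → σ i · P h (n ∸ k)) (≡.sym (ℕ.+-suc j k)))))

module Zeros {ℓ} (ℝ : CompleteOrderedField ℓ) where

  open CompleteOrderedField ℝ using (_≈_; _<_; 0#; rawRing)
  open ComplexNumbers ℝ
  private
    module ℝ[X] = Polynomials rawRing
    module ℂ[X] = Polynomials ℂ-rawRing

  complexify : ℝ[X].Poly → ℂ[X].Poly
  complexify = map ofReal

  IsUniqueZeroOfMaximalModulus : ℂ[X].Poly → ℂ → Set ℓ
  IsUniqueZeroOfMaximalModulus p α = ℂ[X].IsZero p α ×
    (∀ β → ℂ[X].IsZero p β → ¬ RawRing._≈_ ℂ-rawRing β α → modulus β < modulus α)

  IsReal : ℂ → Set ℓ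
  IsReal z = im z ≈ 0#

  IsNegativeReal : ℂ → Set ℓ
  IsNegativeReal z = IsReal z × re z < 0#

{-# OPTIONS --safe #-}

-- Put y_m(x) = (-1)^m P_m(-x) and f = Σ (-1)^k σ(k+1) x^k. If 1/f = Σ d_j x^j, the
-- defining recurrence inverts to
--   x y_m = h(m+1) y_{m+1} + Σ_{1≤j≤m} d_j h(m+1-j) y_{m+1-j}   (m ≥ 1),
-- the eigenvector equation of a Hessenberg matrix whose entries are positive once
-- all d_j > 0, and then a Perron-Frobenius argument applies. At the largest real
-- root of y_m the recurrence makes y_{m+1} negative, so the largest real roots
-- increase with m; let r be that of y_n. If a complex x has modulus ρ ≥ r and
-- x ≠ ρ, the triangle inequality in the recurrence, strict at the diagonal term,
-- shows by induction that |y_{m+1}(x)| / |y_m(x)| exceeds y_{m+1}(ρ) / y_m(ρ), so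
-- y_n(x) ≠ 0. The same induction for derivatives gives y_n′(r) > 0, so r is simple.
-- For d_j > 0, f is the logarithmic derivative of ∏ (1 - (-x)^m); multiplying f by
-- the first terms 1 + x - x² of the product gives a series g whose inverse has
-- coefficients b_n with b_{n+1} ≥ 2 b_n, and d = (1 + x - x²) b.
module Submission where

open import Defs
open import Algebra.Bundles using (CommutativeRing; RawRing)
import Algebra.Definitions.RawMagma as RawMagmaDefinitions
import Algebra.Morphism.Construct.Composition as Composition
import Algebra.Morphism.Construct.Identity as Identity
open import Algebra.Morphism.Structures using (module RingMorphisms)
open import Algebra.Solver.Ring.AlmostCommutativeRing
  using (fromCommutativeRing; _-Raw-AlmostCommutative⟶_)
open import Data.Integer.Base as ℤ using (ℤ; +_; -[1+_]; _⊖_)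
import Data.Integer.Properties as ℤ
open import Data.Integer.Solver using (module +-*-Solver)
open import Data.List.Base using ([]; _∷_; map; filter; applyUpTo)
open import Data.List.Properties using (map-∘)
open import Data.Maybe.Base using (nothing; just; Maybe)
open import Data.Nat.Base as ℕ using (ℕ; zero; suc)
open import Data.Nat.Divisibility using (_∣?_)
open import Data.Nat.ListAction using (sum)
import Data.Nat.Properties as ℕ
open import Data.Product.Base using (_×_; _,_; ∃; proj₁; proj₂)
open import Data.Sum.Base using (inj₁; inj₂; [_,_]′)
open import Function.Base using (_∘_; id)
open import Level using (Level)
open import Relation.Binary.Bundles using (StrictTotalOrder)
import Relation.Binary.Construct.StrictToNonStrict as StrictToNonStrict
open import Relation.Binary.Definitions using (tri<; tri≈; tri>)
import Relation.Binary.Properties.StrictTotalOrder as StrictTotalOrderProperties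
open import Relation.Binary.PropositionalEquality.Core as ≡ using (_≡_)
open import Relation.Nullary using (¬_; yes; no)
open import Relation.Nullary.Decidable using (True; toWitness; from-yes)
open import Relation.Nullary.Negation using (contradiction)
open import Relation.Unary using (Decidable)
open RingMorphisms using (IsRingHomomorphism)

-- The obstacle is the sign of d: f has alternating, growing coefficients, and nothing in them shows
-- that 1/f is positive. The product begins 1 + x - x² - x⁵, and f times it is its derivative 1 - 2x
-- - 5x⁴ - ⋯, whose term -2x drives the doubling. Truncating the product keeps these coefficients
-- and makes every further coefficient of g a combination of three consecutive values of f. For
-- those the bound σ(n) ≤ n² is enough, because doubling weights the coefficient i places further
-- along by at most 2^(-i).
--
-- The recurrence is derived once, over any ring receiving ℝ, and read in ℝ, in ℂ and in the dual
-- numbers ℝ[ε]; the last yields the recurrence for derivatives without a calculus of derivatives.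
-- No matrix is formed. Moduli and derivatives are both treated as supersolutions of the real
-- recurrence, and one lemma, `comparison`, compares either with a positive solution. Ratios are
-- compared by cross-multiplication, since at the root itself the last value is 0.

isRingHomomorphism : ∀ {c₁ ℓ₁ c₂ ℓ₂} (R : CommutativeRing c₁ ℓ₁) (S : CommutativeRing c₂ ℓ₂) →
  let module R = CommutativeRing R; module S = CommutativeRing S in
  (φ : R.Carrier → S.Carrier) →
  (∀ {x y} → x R.≈ y → φ x S.≈ φ y) →
  (∀ x y → φ (x R.+ y) S.≈ φ x S.+ φ y) →
  (∀ x y → φ (x R.* y) S.≈ φ x S.* φ y) →
  φ R.0# S.≈ S.0# → φ R.1# S.≈ S.1# → (∀ x → φ (R.- x) S.≈ S.- φ x) →
  IsRingHomomorphism R.rawRing S.rawRing φ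
isRingHomomorphism R S φ φ-cong φ-+ φ-* φ-0 φ-1 φ-neg = record
  { isSemiringHomomorphism = record
    { isNearSemiringHomomorphism = record
      { +-isMonoidHomomorphism = record
        { isMagmaHomomorphism = record
          { isRelHomomorphism = record { cong = φ-cong } ; homo = φ-+ }
        ; ε-homo = φ-0 }
      ; *-homo = φ-* }
    ; 1#-homo = φ-1 }
  ; -‿homo = φ-neg }

-- Integers in a commutative ring, and the ring solver with integer coefficients

module IntegerMultiples {c ℓ : Level} (R : CommutativeRing c ℓ) where

  open CommutativeRing R
  open import Algebra.Properties.Semiring.Mult.TCOptimised semiring
    using (1+×; ×-homo-+; ×1-homo-*) renaming (_×_ to _·_)
  open import Algebra.Properties.Ring ring
  open import Algebra.Properties.AbelianGroup +-abelianGroup using (⁻¹-∙-comm)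
  open import Relation.Binary.Reasoning.Setoid setoid

  -- With this variant of multiples, `ι (+ 0)` and `ι (+ 1)` reduce to `0#` and `1#`, so that solver
  -- constants match the literals in goals by computation. Integer coefficients give the solver a
  -- decidable equality, which the ring itself may lack.
  ι : ℤ → Carrier
  ι (+ n)    = n · 1#
  ι -[1+ n ] = - (suc n · 1#)

  ι-neg : ∀ i → ι (ℤ.- i) ≈ - ι i
  ι-neg (+ zero)  = sym -0#≈0#
  ι-neg (+ suc n) = refl
  ι-neg -[1+ n ]  = sym (-‿involutive _)

  ι-⊖ : ∀ m n → ι (m ⊖ n) ≈ m · 1# - n · 1#
  ι-⊖ zero    zero    = sym (-‿inverseʳ 0#)
  ι-⊖ zero    (suc n) = sym (+-identityˡ _)
  ι-⊖ (suc m) zero    = sym (trans (+-congˡ -0#≈0#) (+-identityʳ _))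
  ι-⊖ (suc m) (suc n) = begin
    ι (suc m ⊖ suc n)                    ≡⟨ ≡.cong ι (ℤ.[1+m]⊖[1+n]≡m⊖n m n) ⟩
    ι (m ⊖ n)                            ≈⟨ ι-⊖ m n ⟩
    m · 1# - n · 1#                      ≈⟨ +-congʳ (+-identityˡ _) ⟨
    0# + m · 1# - n · 1#                 ≈⟨ +-congʳ (+-congʳ (-‿inverseʳ 1#)) ⟨
    1# - 1# + m · 1# - n · 1#            ≈⟨ +-congʳ (trans (+-assoc _ _ _)
                                                (trans (+-congˡ (+-comm _ _)) (sym (+-assoc _ _ _)))) ⟩
    1# + m · 1# - 1# - n · 1#            ≈⟨ trans (+-assoc _ _ _) (+-congˡ (⁻¹-∙-comm _ _)) ⟩
    1# + m · 1# - (1# + n · 1#)          ≈⟨ +-cong (1+× m 1#) (-‿cong (1+× n 1#)) ⟨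
    suc m · 1# - suc n · 1#              ∎

  ι-+ : ∀ i j → ι (i ℤ.+ j) ≈ ι i + ι j
  ι-+ (+ m)    (+ n)    = ×-homo-+ 1# m n
  ι-+ (+ m)    -[1+ n ] = ι-⊖ m (suc n)
  ι-+ -[1+ m ] (+ n)    = trans (ι-⊖ n (suc m)) (+-comm _ _)
  ι-+ -[1+ m ] -[1+ n ] = begin
    - (suc (suc (m ℕ.+ n)) · 1#)   ≡⟨ ≡.cong (λ k → - (k · 1#)) (≡.cong suc (ℕ.+-suc m n)) ⟨
    - ((suc m ℕ.+ suc n) · 1#)     ≈⟨ -‿cong (×-homo-+ 1# (suc m) (suc n)) ⟩
    - (suc m · 1# + suc n · 1#)    ≈⟨ ⁻¹-∙-comm _ _ ⟨
    - (suc m · 1#) - suc n · 1#    ∎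

  ι-*-pos : ∀ m j → ι (+ m ℤ.* j) ≈ m · 1# * ι j
  ι-*-pos m (+ n) = trans (reflexive (≡.cong ι (≡.sym (ℤ.pos-* m n)))) (×1-homo-* m n)
  ι-*-pos m -[1+ n ] = begin
    ι (+ m ℤ.* (ℤ.- (+ suc n)))  ≡⟨ ≡.cong ι (ℤ.neg-distribʳ-* (+ m) (+ suc n)) ⟨
    ι (ℤ.- (+ m ℤ.* + suc n))    ≈⟨ ι-neg (+ m ℤ.* + suc n) ⟩
    - ι (+ m ℤ.* + suc n)        ≈⟨ -‿cong (ι-*-pos m (+ suc n)) ⟩
    - (m · 1# * suc n · 1#)      ≈⟨ -‿distribʳ-* _ _ ⟩
    m · 1# * - (suc n · 1#)      ∎

  ι-* : ∀ i j → ι (i ℤ.* j) ≈ ι i * ι j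
  ι-* (+ m)    j = ι-*-pos m j
  ι-* -[1+ m ] j = begin
    ι ((ℤ.- (+ suc m)) ℤ.* j)    ≡⟨ ≡.cong ι (ℤ.neg-distribˡ-* (+ suc m) j) ⟨
    ι (ℤ.- (+ suc m ℤ.* j))      ≈⟨ ι-neg (+ suc m ℤ.* j) ⟩
    - ι (+ suc m ℤ.* j)          ≈⟨ -‿cong (ι-*-pos (suc m) j) ⟩
    - (suc m · 1# * ι j)         ≈⟨ -‿distribˡ-* _ _ ⟩
    - (suc m · 1#) * ι j         ∎

  ι-isRingHomomorphism : IsRingHomomorphism ℤ.+-*-rawRing rawRing ι
  ι-isRingHomomorphism = isRingHomomorphism ℤ.+-*-commutativeRing R ι (λ { ≡.refl → refl })
    ι-+ ι-* refl refl ι-neg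

  private
    morphism : ℤ.+-*-rawRing -Raw-AlmostCommutative⟶ fromCommutativeRing R
    morphism = record
      { ⟦_⟧ = ι ; +-homo = ι-+ ; *-homo = ι-* ; -‿homo = ι-neg ; 0-homo = refl ; 1-homo = refl }

    equal? : ∀ i j → Maybe (ι i ≈ ι j)
    equal? i j with i ℤ.≟ j
    ... | yes i≡j = just (reflexive (≡.cong ι i≡j))
    ... | no  _   = nothing

  open import Algebra.Solver.Ring ℤ.+-*-rawRing (fromCommutativeRing R) morphism equal? public
    using (solve; con; _:=_; _:+_; _:*_; _:-_; :-_)

-- Formal power series

module PowerSeries {c ℓ : Level} (R : CommutativeRing c ℓ) where

  open CommutativeRing R
  open import Relation.Binary.Reasoning.Setoid setoid
  open IntegerMultiples R using (solve; con; _:=_; _:+_; _:*_; :-_)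

  Series : Set c
  Series = ℕ → Carrier

  infix 4 _≋_
  _≋_ : Series → Series → Set ℓ
  a ≋ b = ∀ n → a n ≈ b n

  infixl 7 _⋆_
  -- The Cauchy product. Splitting off the constant term of the left factor makes it structurally
  -- recursive in the index, so the ring laws follow by induction without manipulating finite sums.
  _⋆_ : Series → Series → Series
  (a ⋆ b) zero    = a 0 * b 0
  (a ⋆ b) (suc n) = a 0 * b (suc n) + ((a ∘ suc) ⋆ b) n

  unit : Series
  unit zero    = 1#
  unit (suc _) = 0#

  sgn : Series
  sgn zero    = 1#
  sgn (suc n) = - sgn n

  ⋆-cong : ∀ {a a′ b b′} → a ≋ a′ → b ≋ b′ → a ⋆ b ≋ a′ ⋆ b′
  ⋆-cong p q zero    = *-cong (p 0) (q 0)
  ⋆-cong p q (suc n) = +-cong (*-cong (p 0) (q (suc n))) (⋆-cong (p ∘ suc) q n)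

  ⋆-sucʳ : ∀ a b n → (a ⋆ b) (suc n) ≈ a (suc n) * b 0 + (a ⋆ (b ∘ suc)) n
  ⋆-sucʳ a b zero    = +-comm _ _
  ⋆-sucʳ a b (suc n) = begin
    a 0 * b (suc (suc n)) + ((a ∘ suc) ⋆ b) (suc n)
      ≈⟨ +-congˡ (⋆-sucʳ (a ∘ suc) b n) ⟩
    a 0 * b (suc (suc n)) + (a (suc (suc n)) * b 0 + ((a ∘ suc) ⋆ (b ∘ suc)) n)
      ≈⟨ solve 3 (λ x y z → x :+ (y :+ z) := y :+ (x :+ z)) refl _ _ _ ⟩
    a (suc (suc n)) * b 0 + (a ⋆ (b ∘ suc)) (suc n) ∎

  ⋆-comm : ∀ a b → a ⋆ b ≋ b ⋆ a
  ⋆-comm a b zero    = *-comm _ _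
  ⋆-comm a b (suc n) = begin
    a 0 * b (suc n) + ((a ∘ suc) ⋆ b) n  ≈⟨ +-cong (*-comm _ _) (⋆-comm (a ∘ suc) b n) ⟩
    b (suc n) * a 0 + (b ⋆ (a ∘ suc)) n  ≈⟨ ⋆-sucʳ b a n ⟨
    (b ⋆ a) (suc n)                      ∎

  -- Shaped for `⋆-assoc`: the tail of a product `a ⋆ b` is `a 0` times the tail of `b` plus the
  -- product of the tail of `a` with `b`.
  ⋆-linearˡ : ∀ x a b c → (λ i → x * a i + b i) ⋆ c ≋ λ n → x * (a ⋆ c) n + (b ⋆ c) n
  ⋆-linearˡ x a b c zero    =
    solve 4 (λ x a b c → (x :* a :+ b) :* c := x :* (a :* c) :+ b :* c) refl _ _ _ _
  ⋆-linearˡ x a b c (suc n) = trans (+-congˡ (⋆-linearˡ x (a ∘ suc) (b ∘ suc) c n))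
    (solve 6 (λ x a b c p q → (x :* a :+ b) :* c :+ (x :* p :+ q)
                            := x :* (a :* c :+ p) :+ (b :* c :+ q)) refl _ _ _ _ _ _)

  ⋆-assoc : ∀ a b c → (a ⋆ b) ⋆ c ≋ a ⋆ (b ⋆ c)
  ⋆-assoc a b c zero    = *-assoc _ _ _
  ⋆-assoc a b c (suc n) = begin
    a 0 * b 0 * c (suc n) + ((λ i → a 0 * b (suc i) + ((a ∘ suc) ⋆ b) i) ⋆ c) n
      ≈⟨ +-congˡ (⋆-linearˡ (a 0) (b ∘ suc) ((a ∘ suc) ⋆ b) c n) ⟩
    a 0 * b 0 * c (suc n) + (a 0 * ((b ∘ suc) ⋆ c) n + (((a ∘ suc) ⋆ b) ⋆ c) n)
      ≈⟨ +-congˡ (+-congˡ (⋆-assoc (a ∘ suc) b c n)) ⟩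
    a 0 * b 0 * c (suc n) + (a 0 * ((b ∘ suc) ⋆ c) n + ((a ∘ suc) ⋆ (b ⋆ c)) n)
      ≈⟨ solve 5 (λ a b c p q → a :* b :* c :+ (a :* p :+ q) := a :* (b :* c :+ p) :+ q)
           refl _ _ _ _ _ ⟩
    a 0 * (b ⋆ c) (suc n) + ((a ∘ suc) ⋆ (b ⋆ c)) n ∎

  ⋆-zeroˡ : ∀ b → (λ _ → 0#) ⋆ b ≋ λ _ → 0#
  ⋆-zeroˡ b zero    = zeroˡ _
  ⋆-zeroˡ b (suc n) = trans (+-cong (zeroˡ _) (⋆-zeroˡ b n)) (+-identityˡ _)

  ⋆-identityˡ : ∀ b → unit ⋆ b ≋ b
  ⋆-identityˡ b zero    = *-identityˡ _
  ⋆-identityˡ b (suc n) =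
    trans (+-cong (*-identityˡ _) (⋆-zeroˡ b n)) (+-identityʳ _)

  mutual
    -- The inverse of a series whose constant term is 1#; that term is not inspected.
    inverse : Series → Series
    inverse g zero    = 1#
    inverse g (suc n) = - inverse-tail g 1 n

    -- inverse-tail g j n = Σ_{i≤n} g(j+i) b(n-i), where b = inverse g; the
    -- shift j makes the recursion structural.
    inverse-tail : Series → ℕ → ℕ → Carrier
    inverse-tail g j zero    = g j * 1#
    inverse-tail g j (suc n) = g j * - inverse-tail g 1 n + inverse-tail g (suc j) n

  inverse-tail-⋆ : ∀ g j → inverse-tail g j ≋ (λ i → g (j ℕ.+ i)) ⋆ inverse g
  inverse-tail-⋆ g j zero    = *-congʳ (reflexive (≡.cong g (≡.sym (ℕ.+-identityʳ j))))
  inverse-tail-⋆ g j (suc n) = +-cong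
    (*-congʳ (reflexive (≡.cong g (≡.sym (ℕ.+-identityʳ j)))))
    (trans (inverse-tail-⋆ g (suc j) n)
      (⋆-cong (λ i → reflexive (≡.cong g (≡.sym (ℕ.+-suc j i)))) (λ _ → refl) n))

  inverse-suc : ∀ g n → inverse g (suc n) ≈ - ((g ∘ suc) ⋆ inverse g) n
  inverse-suc g n = -‿cong (inverse-tail-⋆ g 1 n)

  ⋆-inverseʳ : ∀ {g} → g 0 ≈ 1# → g ⋆ inverse g ≋ unit
  ⋆-inverseʳ e zero    = trans (*-congʳ e) (*-identityˡ _)
  ⋆-inverseʳ {g} e (suc n) = begin
    g 0 * inverse g (suc n) + ((g ∘ suc) ⋆ inverse g) n
      ≈⟨ +-congʳ (trans (*-congʳ e) (trans (*-identityˡ _) (inverse-suc g n))) ⟩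
    - ((g ∘ suc) ⋆ inverse g) n + ((g ∘ suc) ⋆ inverse g) n
      ≈⟨ -‿inverseˡ _ ⟩
    0# ∎

  ⋆-negˡ : ∀ a b → (λ i → - a i) ⋆ b ≋ λ n → - (a ⋆ b) n
  ⋆-negˡ a b zero    = solve 2 (λ a b → :- a :* b := :- (a :* b)) refl _ _
  ⋆-negˡ a b (suc n) = trans (+-congˡ (⋆-negˡ (a ∘ suc) b n))
    (solve 3 (λ a b p → :- a :* b :+ :- p := :- (a :* b :+ p)) refl _ _ _)

  ⋆-scaleʳ : ∀ x a b → a ⋆ (λ i → x * b i) ≋ λ n → x * (a ⋆ b) n
  ⋆-scaleʳ x a b zero    = solve 3 (λ x a b → a :* (x :* b) := x :* (a :* b)) refl _ _ _
  ⋆-scaleʳ x a b (suc n) = trans (+-congˡ (⋆-scaleʳ x (a ∘ suc) b n))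
    (solve 4 (λ x a b p → a :* (x :* b) :+ x :* p := x :* (a :* b :+ p)) refl _ _ _ _)

  -- The substitution of -x for x is multiplicative on power series.
  sgn-⋆ : ∀ a b → (λ i → sgn i * a i) ⋆ (λ i → sgn i * b i) ≋ λ n → sgn n * (a ⋆ b) n
  sgn-⋆ a b zero    = solve 2 (λ a b → con (+ 1) :* a :* (con (+ 1) :* b)
                                    := con (+ 1) :* (a :* b)) refl _ _
  sgn-⋆ a b (suc n) = begin
    1# * a 0 * (- sgn n * b (suc n)) + ((λ i → - sgn i * a (suc i)) ⋆ (λ i → sgn i * b i)) n
      ≈⟨ +-congˡ (⋆-cong (λ i → solve 2 (λ s a → :- s :* a := s :* :- a) refl (sgn i) (a (suc i)))
                         (λ _ → refl) n) ⟩
    1# * a 0 * (- sgn n * b (suc n)) + ((λ i → sgn i * - a (suc i)) ⋆ (λ i → sgn i * b i)) n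
      ≈⟨ +-congˡ (trans (sgn-⋆ (λ i → - a (suc i)) b n) (*-congˡ (⋆-negˡ (a ∘ suc) b n))) ⟩
    1# * a 0 * (- sgn n * b (suc n)) + sgn n * - ((a ∘ suc) ⋆ b) n
      ≈⟨ solve 4 (λ s a b p → con (+ 1) :* a :* (:- s :* b) :+ s :* :- p := :- s :* (a :* b :+ p))
           refl _ _ _ _ ⟩
    - sgn n * (a ⋆ b) (suc n) ∎

  -- The highest index is added last, so that unfolding a sum over row m of the Hessenberg matrix
  -- isolates the diagonal term.
  sum< : ℕ → Series → Carrier
  sum< zero    a = 0#
  sum< (suc n) a = sum< n a + a n

  sum<-cong : ∀ n {a b : Series} → (∀ {i} → i ℕ.< n → a i ≈ b i) → sum< n a ≈ sum< n b
  sum<-cong zero    e = refl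
  sum<-cong (suc n) e = +-cong (sum<-cong n (e ∘ ℕ.m<n⇒m<1+n)) (e ℕ.≤-refl)

  ⋆-sum : ∀ a b n → (a ⋆ b) n ≈ sum< (suc n) (λ i → a (n ℕ.∸ i) * b i)
  ⋆-sum a b zero    = sym (+-identityˡ _)
  ⋆-sum a b (suc n) = begin
    a 0 * b (suc n) + ((a ∘ suc) ⋆ b) n
      ≈⟨ +-comm _ _ ⟩
    ((a ∘ suc) ⋆ b) n + a 0 * b (suc n)
      ≈⟨ +-cong (⋆-sum (a ∘ suc) b n) (*-congʳ (reflexive (≡.cong a (≡.sym (ℕ.n∸n≡0 n))))) ⟩
    sum< (suc n) (λ i → a (suc (n ℕ.∸ i)) * b i) + a (n ℕ.∸ n) * b (suc n)
      ≈⟨ +-congʳ (sum<-cong (suc n) λ { {i} (ℕ.s≤s i≤n) →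
           *-congʳ (reflexive (≡.cong a (≡.sym (ℕ.+-∸-assoc 1 i≤n)))) }) ⟩
    sum< (suc n) (λ i → a (suc n ℕ.∸ i) * b i) + a (n ℕ.∸ n) * b (suc n) ∎

module SeriesHomomorphism {c₁ ℓ₁ c₂ ℓ₂ : Level} (R : CommutativeRing c₁ ℓ₁)
  (S : CommutativeRing c₂ ℓ₂) (φ : CommutativeRing.Carrier R → CommutativeRing.Carrier S)
  (φ-hom : IsRingHomomorphism (CommutativeRing.rawRing R) (CommutativeRing.rawRing S) φ) where

  open CommutativeRing S
  open IsRingHomomorphism φ-hom
  private
    module R = PowerSeries R
    module S = PowerSeries S

  ⋆-homo : ∀ a b n → φ ((a R.⋆ b) n) ≈ ((φ ∘ a) S.⋆ (φ ∘ b)) n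
  ⋆-homo a b zero    = *-homo _ _
  ⋆-homo a b (suc n) = trans (+-homo _ _) (+-cong (*-homo _ _) (⋆-homo (a ∘ suc) b n))

  unit-homo : ∀ n → φ (R.unit n) ≈ S.unit n
  unit-homo zero    = 1#-homo
  unit-homo (suc _) = 0#-homo

  sgn-homo : ∀ n → φ (R.sgn n) ≈ S.sgn n
  sgn-homo zero    = 1#-homo
  sgn-homo (suc n) = trans (-‿homo _) (-‿cong (sgn-homo n))

-- Positivity of the coefficients of 1/f

sum-filter-applyUpTo≤ : ∀ {p} {P : ℕ → Set p} (P? : Decidable P) f c n →
  (∀ {i} → i ℕ.< n → f i ℕ.≤ c) → sum (filter P? (applyUpTo f n)) ℕ.≤ n ℕ.* c
sum-filter-applyUpTo≤ P? f c zero    bound = ℕ.z≤n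
sum-filter-applyUpTo≤ P? f c (suc n) bound with P? (f 0)
... | yes _ = ℕ.+-mono-≤ (bound ℕ.z<s) (sum-filter-applyUpTo≤ P? (f ∘ suc) c n (bound ∘ ℕ.s<s))
... | no  _ = ℕ.≤-trans (sum-filter-applyUpTo≤ P? (f ∘ suc) c n (bound ∘ ℕ.s<s)) (ℕ.m≤n+m _ c)

-- There are at most n divisors, each at most n.
σ[n]≤n² : ∀ n → σ n ℕ.≤ n ℕ.* n
σ[n]≤n² n = sum-filter-applyUpTo≤ (_∣? n) suc n n id

module DivisorSeries where

  open import Data.Integer.Base using (_+_; _*_; _-_; -_; _≤_; _<_; 0ℤ; 1ℤ)
  open PowerSeries ℤ.+-*-commutativeRing public
  open +-*-Solver using (solve; con; _:=_; _:+_; _:*_; _:-_; :-_)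

  +-nonNeg : ∀ {i j} → 0ℤ ≤ i → 0ℤ ≤ j → 0ℤ ≤ i + j
  +-nonNeg = ℤ.+-mono-≤

  *-nonNeg : ∀ {i j} → 0ℤ ≤ i → 0ℤ ≤ j → 0ℤ ≤ i * j
  *-nonNeg {+ m} {+ n} _ _ = ≡.subst (0ℤ ≤_) (ℤ.pos-* m n) (ℤ.+≤+ ℕ.z≤n)

  nonNeg⇒≤ : ∀ {i j k} → 0ℤ ≤ k → k ≡ j - i → i ≤ j
  nonNeg⇒≤ 0≤k ≡.refl = ℤ.0≤i-j⇒j≤i 0≤k

  ≤⇒nonNeg = λ {i j} → ℤ.i≤j⇒0≤j-i {i} {j}

  f : Series
  f k = sgn k * + σ (suc k)

  -- Chosen so that g = 1 - 2x - 5x⁴ + ⋯ has vanishing coefficients 2 and 3.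
  multiplier : Series
  multiplier 0 = 1ℤ
  multiplier 1 = 1ℤ
  multiplier 2 = ℤ.-1ℤ
  multiplier _ = 0ℤ

  g : Series
  g = multiplier ⋆ f

  b : Series
  b = inverse g

  sgn-bound : ∀ k i → 0ℤ ≤ i → sgn k * i ≤ i × - (sgn k * i) ≤ i
  sgn-bound zero    i 0≤i = ℤ.≤-reflexive (ℤ.*-identityˡ i)
    , ≡.subst (λ j → - j ≤ i) (≡.sym (ℤ.*-identityˡ i)) (ℤ.≤-trans (ℤ.neg-mono-≤ 0≤i) 0≤i)
  sgn-bound (suc k) i 0≤i with sgn-bound k i 0≤i
  ... | p , q = ≡.subst (_≤ i) (ℤ.neg-distribˡ-* (sgn k) i) q
    , ≡.subst (_≤ i) (solve 2 (λ s i → s :* i := :- (:- s :* i)) ≡.refl (sgn k) i) p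

  f-bound : ∀ k → f k ≤ + suc k * + suc k × - f k ≤ + suc k * + suc k
  f-bound k with sgn-bound k (+ σ (suc k)) (ℤ.+≤+ ℕ.z≤n)
  ... | p , q = ℤ.≤-trans p σ≤ , ℤ.≤-trans q σ≤
    where
    σ≤ : + σ (suc k) ≤ + suc k * + suc k
    σ≤ = ℤ.+≤+ (σ[n]≤n² (suc k))

  multiplier-⋆ : ∀ a n → (multiplier ⋆ a) (2 ℕ.+ n) ≡ a (2 ℕ.+ n) + a (1 ℕ.+ n) - a n
  multiplier-⋆ a zero    = solve 3 (λ x y z →
    con 1ℤ :* x :+ (con 1ℤ :* y :+ con ℤ.-1ℤ :* z) := x :+ y :- z) ≡.refl (a 2) (a 1) (a 0)
  multiplier-⋆ a (suc n) = ≡.trans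
    (≡.cong (λ t → 1ℤ * a (3 ℕ.+ n) + (1ℤ * a (2 ℕ.+ n) + (ℤ.-1ℤ * a (1 ℕ.+ n) + t)))
      (⋆-zeroˡ a n))
    (solve 3 (λ x y z →
      con 1ℤ :* x :+ (con 1ℤ :* y :+ (con ℤ.-1ℤ :* z :+ con 0ℤ)) := x :+ y :- z) ≡.refl
      (a (3 ℕ.+ n)) (a (2 ℕ.+ n)) (a (1 ℕ.+ n)))

  -- U k = 6 j² + 12 j + 22 with j = 11 + k, chosen so that
  -- 2 U k - U (k + 1) = 2 ((j + 1)² + j² + (j - 1)²).
  U : ℕ → ℤ
  U k = + 6 * (+ k * + k) + + 144 * + k + + 880

  -- The three terms of `g j`, j = 11 + k, are at most (j+1)², j² and (j-1)². Thus `U k` is the sum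
  -- over i of 2^(-i) times the resulting bound for `g (j + i)`, and the claim is one step of that
  -- series, doubled to stay in ℤ.
  g-bound : ∀ k → + 2 * g (11 ℕ.+ k) + U (suc k) ≤ + 2 * U k
  g-bound k = nonNeg⇒≤ (*-nonNeg {+ 2} (ℤ.+≤+ ℕ.z≤n)
      (+-nonNeg (+-nonNeg (≤⇒nonNeg (proj₁ (f-bound (11 ℕ.+ k)))) (≤⇒nonNeg (proj₁ (f-bound (10 ℕ.+ k)))))
                (≤⇒nonNeg (proj₂ (f-bound (9 ℕ.+ k))))))
    (≡.trans (identity (+ k) (f (11 ℕ.+ k)) (f (10 ℕ.+ k)) (f (9 ℕ.+ k)))
       (≡.cong (λ t → + 2 * U k - (+ 2 * t + U (suc k))) (≡.sym (multiplier-⋆ f (9 ℕ.+ k)))))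
    where
    identity : ∀ k x y z →
      + 2 * (((+ 12 + k) * (+ 12 + k) - x) + ((+ 11 + k) * (+ 11 + k) - y)
              + ((+ 10 + k) * (+ 10 + k) - - z))
      ≡ + 2 * (+ 6 * (k * k) + + 144 * k + + 880)
        - (+ 2 * (x + y - z) + (+ 6 * ((+ 1 + k) * (+ 1 + k)) + + 144 * (+ 1 + k) + + 880))
    identity = solve 4 (λ k x y z →
      con (+ 2) :* (((con (+ 12) :+ k) :* (con (+ 12) :+ k) :- x)
        :+ ((con (+ 11) :+ k) :* (con (+ 11) :+ k) :- y)
        :+ ((con (+ 10) :+ k) :* (con (+ 10) :+ k) :- :- z))
      := con (+ 2) :* (con (+ 6) :* (k :* k) :+ con (+ 144) :* k :+ con (+ 880))
        :- (con (+ 2) :* (x :+ y :- z)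
          :+ (con (+ 6) :* ((con (+ 1) :+ k) :* (con (+ 1) :+ k))
            :+ con (+ 144) :* (con (+ 1) :+ k) :+ con (+ 880)))) ≡.refl

  0≤U : ∀ k → 0ℤ ≤ U k
  0≤U k = +-nonNeg (+-nonNeg (*-nonNeg {+ 6} (ℤ.+≤+ ℕ.z≤n)
      (*-nonNeg {+ k} {+ k} (ℤ.+≤+ ℕ.z≤n) (ℤ.+≤+ ℕ.z≤n)))
    (*-nonNeg {+ 144} {+ k} (ℤ.+≤+ ℕ.z≤n) (ℤ.+≤+ ℕ.z≤n))) (ℤ.+≤+ ℕ.z≤n)

  DoublingBelow : ℕ → Set
  DoublingBelow n = ∀ {i} → i ℕ.< n → + 2 * b i ≤ b (suc i)

  doubling⇒nonNeg : ∀ {n} → DoublingBelow n → 0ℤ ≤ b n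
  doubling⇒nonNeg {zero}  p = ℤ.+≤+ ℕ.z≤n
  doubling⇒nonNeg {suc n} p = ℤ.≤-trans
    (*-nonNeg {+ 2} (ℤ.+≤+ ℕ.z≤n) (doubling⇒nonNeg (p ∘ ℕ.m<n⇒m<1+n))) (p ℕ.≤-refl)

  tail : ℕ → Series
  tail j = (λ i → g (j ℕ.+ i)) ⋆ b

  tail-suc : ∀ j n → tail j (suc n) ≡ g j * b (suc n) + tail (suc j) n
  tail-suc j n = ≡.cong₂ _+_ (≡.cong (λ k → g k * b (suc n)) (ℕ.+-identityʳ j))
    (⋆-cong (λ i → ≡.cong g (ℕ.+-suc j i)) (λ _ → ≡.refl) n)

  tail-zero : ∀ j → tail j 0 ≡ g j
  tail-zero j = ≡.trans (ℤ.*-identityʳ _) (≡.cong g (ℕ.+-identityʳ j))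

  private
    halve : ∀ {i j} → + 2 * i ≤ + 2 * j → i ≤ j
    halve = ℤ.*-cancelˡ-≤-pos _ _ (+ 2)

  tail-bound-zero : ∀ j {u u′} → 0ℤ ≤ u′ → + 2 * g j + u′ ≤ + 2 * u → tail j 0 ≤ u * b 0
  tail-bound-zero j {u} {u′} 0≤u′ p = halve (nonNeg⇒≤ (+-nonNeg (≤⇒nonNeg p) 0≤u′)
    (≡.trans (solve 3 (λ u u′ g → con (+ 2) :* u :- (con (+ 2) :* g :+ u′) :+ u′
                 := con (+ 2) :* (u :* con 1ℤ) :- con (+ 2) :* g) ≡.refl u u′ (g j))
      (≡.cong (λ t → + 2 * (u * 1ℤ) - + 2 * t) (≡.sym (tail-zero j)))))

  -- The hypothesis is g j + u′/2 ≤ u with the denominator cleared; the conclusion is likewise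
  -- proved doubled and then halved. Upper bounds suffice, since only a large positive tail could
  -- spoil the doubling.
  tail-bound-suc : ∀ j {u u′} n → 0ℤ ≤ u′ → + 2 * g j + u′ ≤ + 2 * u →
    DoublingBelow (suc n) → tail (suc j) n ≤ u′ * b n → tail j (suc n) ≤ u * b (suc n)
  tail-bound-suc j {u} {u′} n 0≤u′ p doubling q = halve (nonNeg⇒≤
    (+-nonNeg (+-nonNeg (*-nonNeg (≤⇒nonNeg p) (doubling⇒nonNeg doubling))
        (*-nonNeg 0≤u′ (≤⇒nonNeg (doubling ℕ.≤-refl))))
      (*-nonNeg {+ 2} (ℤ.+≤+ ℕ.z≤n) (≤⇒nonNeg q)))
    (≡.trans (solve 6 (λ u u′ g b b′ t →
        (con (+ 2) :* u :- (con (+ 2) :* g :+ u′)) :* b′ :+ u′ :* (b′ :- con (+ 2) :* b)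
          :+ con (+ 2) :* (u′ :* b :- t)
        := con (+ 2) :* (u :* b′) :- con (+ 2) :* (g :* b′ :+ t))
        ≡.refl u u′ (g j) (b n) (b (suc n)) (tail (suc j) n))
      (≡.cong (λ t → + 2 * (u * b (suc n)) - + 2 * t) (≡.sym (tail-suc j n)))))

  tail-bound-far : ∀ n k → DoublingBelow n → tail (11 ℕ.+ k) n ≤ U k * b n
  tail-bound-far zero    k _        = tail-bound-zero (11 ℕ.+ k) (0≤U (suc k)) (g-bound k)
  tail-bound-far (suc n) k doubling = tail-bound-suc (11 ℕ.+ k) n (0≤U (suc k)) (g-bound k) doubling
    (≡.subst (λ j → tail j n ≤ U (suc k) * b n) (ℕ.+-suc 11 k)
      (tail-bound-far n (suc k) (doubling ∘ ℕ.m<n⇒m<1+n)))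

  -- As b doubles, tail (j + 1) n ≤ u′ b n gives tail j (n + 1) ≤ (g j + u′ / 2) b (n + 1).
  -- The constants below are propagated from tail-bound-far at j = 11 down to j = 5.
  private
    Bounded : ℕ → ℤ → Set
    Bounded j u = ∀ n → DoublingBelow n → tail j n ≤ u * b n

    step : ∀ j u u′ {_ : True (0ℤ ℤ.≤? u′)} {_ : True (+ 2 * g j + u′ ℤ.≤? + 2 * u)} →
      Bounded (suc j) u′ → Bounded j u
    step j _ _ {p} {q} r zero    _        = tail-bound-zero j (toWitness p) (toWitness q)
    step j _ _ {p} {q} r (suc n) doubling = tail-bound-suc j n (toWitness p) (toWitness q) doubling
      (r n (doubling ∘ ℕ.m<n⇒m<1+n))

  -- The target 10 is what `doubling-step` can pay for. The largest u′ that `step` allows is 2 u - 2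
  -- g j; from 10 this gives 18, 56, 102, 224, 428 and then 894, which is above `U 0` = 880. At j =
  -- 10 the quadratic estimate would be 742, more than 428, so it is used only from j = 11.
  tail-bound : ∀ n → DoublingBelow n → tail 5 n ≤ + 10 * b n
  tail-bound = step 5 (+ 10) (+ 18) (step 6 (+ 18) (+ 56) (step 7 (+ 56) (+ 102)
    (step 8 (+ 102) (+ 224) (step 9 (+ 224) (+ 428) (step 10 (+ 428) (U 0)
      (λ n → tail-bound-far n 0))))))

  doubling-step : ∀ n → DoublingBelow n → + 2 * b n ≤ b (suc n)
  doubling-step 0 _ = from-yes (+ 2 * b 0 ℤ.≤? b 1)
  doubling-step 1 _ = from-yes (+ 2 * b 1 ℤ.≤? b 2)
  doubling-step 2 _ = from-yes (+ 2 * b 2 ℤ.≤? b 3)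
  doubling-step 3 _ = from-yes (+ 2 * b 3 ℤ.≤? b 4)
  -- Coefficients 2 and 3 of `g` vanish, so b (m+5) = 2 b (m+4) + 5 b (m+1) - tail 5 m, and 5 b
  -- (m+1) ≥ 10 b m pays for the tail. The cases before coefficient 4 and a tail separate are
  -- computed.
  doubling-step (suc (suc (suc (suc m)))) doubling = nonNeg⇒≤
    (+-nonNeg (*-nonNeg {+ 5} (ℤ.+≤+ ℕ.z≤n) (≤⇒nonNeg (doubling (ℕ.m≤n+m (suc m) 3))))
              (≤⇒nonNeg (tail-bound m (doubling ∘ ℕ.m≤n⇒m≤o+n 4))))
    (≡.trans (solve 4 (λ b₄ b₁ b₀ t →
        con (+ 5) :* (b₁ :- con (+ 2) :* b₀) :+ (con (+ 10) :* b₀ :- t)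
        := :- (con (ℤ.- (+ 2)) :* b₄ :+ (con (ℤ.- (+ 5)) :* b₁ :+ t)) :- con (+ 2) :* b₄)
        ≡.refl (b (4 ℕ.+ m)) (b (1 ℕ.+ m)) (b m) (tail 5 m))
      (≡.cong (_- + 2 * b (4 ℕ.+ m)) (≡.sym recurrence)))
    where
    recurrence : b (5 ℕ.+ m) ≡
      - (ℤ.- (+ 2) * b (4 ℕ.+ m) + (ℤ.- (+ 5) * b (1 ℕ.+ m) + tail 5 m))
    recurrence = ≡.trans (inverse-suc g (4 ℕ.+ m)) (≡.cong (λ t → - (ℤ.- (+ 2) * b (4 ℕ.+ m) + t))
      (≡.trans (ℤ.+-identityˡ _) (ℤ.+-identityˡ _)))

  doublingBelow : ∀ n → DoublingBelow n
  doublingBelow zero    ()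
  doublingBelow (suc n) {i} i<1+n with ℕ.m<1+n⇒m<n∨m≡n i<1+n
  ... | inj₁ i<n    = doublingBelow n i<n
  ... | inj₂ ≡.refl = doubling-step n (doublingBelow n)

  0<b : ∀ n → 0ℤ < b n
  0<b zero    = ℤ.+<+ ℕ.z<s
  0<b (suc n) = ℤ.<-≤-trans (ℤ.*-monoˡ-<-pos (+ 2) (0<b n)) (doublingBelow (suc n) ℕ.≤-refl)

  d : Series
  d = multiplier ⋆ b

  0<d : ∀ n → 0ℤ < d n
  0<d 0 = ℤ.+<+ ℕ.z<s
  0<d 1 = ℤ.+<+ ℕ.z<s
  -- d (n+2) = b (n+2) + (b (n+1) - 2 b n) + b n, where doubling makes the bracket nonnegative.
  0<d (suc (suc n)) = ≡.subst (0ℤ <_)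
    (≡.trans (solve 3 (λ b₂ b₁ b₀ → b₂ :+ ((b₁ :- con (+ 2) :* b₀) :+ b₀) := b₂ :+ b₁ :- b₀)
        ≡.refl (b (2 ℕ.+ n)) (b (1 ℕ.+ n)) (b n))
      (≡.sym (multiplier-⋆ b n)))
    (ℤ.+-mono-<-≤ (0<b (2 ℕ.+ n))
      (+-nonNeg (≤⇒nonNeg (doublingBelow (suc n) ℕ.≤-refl)) (ℤ.<⇒≤ (0<b n))))

  d⋆f : d ⋆ f ≋ unit
  d⋆f n = ≡.trans (⋆-cong (⋆-comm multiplier b) (λ _ → ≡.refl) n)
    (≡.trans (⋆-assoc b multiplier f n)
    (≡.trans (⋆-comm b g n) (⋆-inverseʳ ≡.refl n)))

-- Factor theorem and evaluation of polynomials

module PolynomialCoefficients {c ℓ : Level} (R : CommutativeRing c ℓ) where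

  open CommutativeRing R
  open Polynomials rawRing
  open PowerSeries R
  open IntegerMultiples R using (solve; con; _:=_; _:+_; _:*_; _:-_; :-_)

  coefficient-⊕ : ∀ p q i → coefficient (p ⊕ q) i ≈ coefficient p i + coefficient q i
  coefficient-⊕ []      q       i       = sym (+-identityˡ _)
  coefficient-⊕ (c ∷ p) []      i       = sym (+-identityʳ _)
  coefficient-⊕ (c ∷ p) (d ∷ q) zero    = refl
  coefficient-⊕ (c ∷ p) (d ∷ q) (suc i) = coefficient-⊕ p q i

  coefficient-map-* : ∀ c p i → coefficient (map (c *_) p) i ≈ c * coefficient p i
  coefficient-map-* c []      i       = sym (zeroʳ c)
  coefficient-map-* c (d ∷ p) zero    = refl
  coefficient-map-* c (d ∷ p) (suc i) = coefficient-map-* c p i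

  coefficient-⊗ : ∀ p q → coefficient (p ⊗ q) ≋ coefficient p ⋆ coefficient q
  coefficient-⊗ []      q i       = sym (⋆-zeroˡ (coefficient q) i)
  coefficient-⊗ (c ∷ p) q zero    = trans (coefficient-⊕ (map (c *_) q) (0# ∷ (p ⊗ q)) 0)
    (trans (+-identityʳ _) (coefficient-map-* c q 0))
  coefficient-⊗ (c ∷ p) q (suc i) = trans (coefficient-⊕ (map (c *_) q) (0# ∷ (p ⊗ q)) (suc i))
    (+-cong (coefficient-map-* c q (suc i)) (coefficient-⊗ p q i))

  -- Synthetic division by X - z: the coefficients of the quotient are the intermediate values of
  -- Horner's scheme. The last one is a harmless trailing zero.
  quotient : Carrier → Poly → Poly
  quotient z []      = []
  quotient z (c ∷ p) = evaluate p z ∷ quotient z p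

  coefficient-quotient : ∀ z p i →
    coefficient (quotient z p) i ≈ coefficient p (suc i) + z * coefficient (quotient z p) (suc i)
  coefficient-quotient z []          i       = sym (trans (+-identityˡ _) (zeroʳ z))
  coefficient-quotient z (c ∷ [])    zero    = sym (trans (+-identityˡ _) (zeroʳ z))
  coefficient-quotient z (c ∷ d ∷ p) zero    = refl
  coefficient-quotient z (c ∷ p)     (suc i) = coefficient-quotient z p i

  evaluate-quotient : ∀ z p → evaluate p z ≈ coefficient p 0 + z * coefficient (quotient z p) 0
  evaluate-quotient z []      = sym (trans (+-identityˡ _) (zeroʳ z))
  evaluate-quotient z (c ∷ p) = refl

  root⇒∣ : ∀ {z} p → IsZero p z → ((X ⊕ constant (- z)) ^ 1) ∣ p
  root⇒∣ {z} p zero-z = quotient z p RawMagmaDefinitions., divides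
    where
    q = coefficient (quotient z p)

    linear : Series
    linear = coefficient ((X ⊕ constant (- z)) ^ 1)

    -- The exponent 1 unfolds to a product with the constant 1, so the coefficients of X - z appear
    -- only after simplification.
    tail-linear : linear ∘ suc ≋ unit
    tail-linear zero          = solve 0 (con (+ 1) :* con (+ 1) :+ con (+ 0) := con (+ 1)) refl
    tail-linear (suc zero)    = refl
    tail-linear (suc (suc i)) = refl

    linear₀ : linear 0 ≈ - z
    linear₀ = solve 1 (λ z → (con (+ 0) :+ :- z) :* con (+ 1) :+ con (+ 0) := :- z) refl z

    divides : ∀ i → coefficient (quotient z p ⊗ ((X ⊕ constant (- z)) ^ 1)) i ≈ coefficient p i
    divides i = trans (coefficient-⊗ (quotient z p) _ i) (trans (⋆-comm q linear i) (expand i))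
      where
      expand : ∀ i → (linear ⋆ q) i ≈ coefficient p i
      expand zero    = trans (*-congʳ linear₀) (trans
        (solve 3 (λ z q p → :- z :* q := p :- (p :+ z :* q)) refl z (q 0) (coefficient p 0))
        (trans (+-congˡ (-‿cong (trans (sym (evaluate-quotient z p)) zero-z)))
          (solve 1 (λ p → p :- con (+ 0) := p) refl _)))
      expand (suc i) = trans
        (+-cong (*-congʳ linear₀) (trans (⋆-cong tail-linear (λ _ → refl) i) (⋆-identityˡ q i)))
        (trans (+-congˡ (coefficient-quotient z p i))
          (solve 3 (λ z q p → :- z :* q :+ (p :+ z :* q) := p) refl z (q (suc i)) _))

module Evaluation {c₁ ℓ₁ c₂ ℓ₂ : Level} (R : CommutativeRing c₁ ℓ₁) (A : CommutativeRing c₂ ℓ₂)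
  (φ : CommutativeRing.Carrier R → CommutativeRing.Carrier A)
  (φ-hom : IsRingHomomorphism (CommutativeRing.rawRing R) (CommutativeRing.rawRing A) φ)
  (z : CommutativeRing.Carrier A) where

  open CommutativeRing A
  open IsRingHomomorphism φ-hom
  open IntegerMultiples A using (solve; con; _:=_; _:+_; _:*_)
  open Polynomials (CommutativeRing.rawRing R) hiding (evaluate)
  open Polynomials rawRing using (evaluate)
  private module R = CommutativeRing R

  -- Points in a ring other than that of the coefficients are allowed: real coefficients are
  -- evaluated at complex points and at dual numbers.
  eval : Poly → Carrier
  eval p = evaluate (map φ p) z

  eval-⊕ : ∀ p q → eval (p ⊕ q) ≈ eval p + eval q
  eval-⊕ []      q       = sym (+-identityˡ _)
  eval-⊕ (c ∷ p) []      = sym (+-identityʳ _)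
  eval-⊕ (c ∷ p) (d ∷ q) = trans (+-cong (+-homo c d) (*-congˡ (eval-⊕ p q)))
    (solve 5 (λ c d z p q → c :+ d :+ z :* (p :+ q) := c :+ z :* p :+ (d :+ z :* q))
      refl _ _ _ _ _)

  eval-map-* : ∀ c p → eval (map (c R.*_) p) ≈ φ c * eval p
  eval-map-* c []      = sym (zeroʳ _)
  eval-map-* c (d ∷ p) = trans (+-cong (*-homo c d) (*-congˡ (eval-map-* c p)))
    (solve 4 (λ c d z p → c :* d :+ z :* (c :* p) := c :* (d :+ z :* p)) refl _ _ _ _)

  eval-⊗ : ∀ p q → eval (p ⊗ q) ≈ eval p * eval q
  eval-⊗ []      q = sym (zeroˡ _)
  eval-⊗ (c ∷ p) q = trans (eval-⊕ (map (c R.*_) q) (R.0# ∷ (p ⊗ q)))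
    (trans (+-cong (eval-map-* c q) (+-cong 0#-homo (*-congˡ (eval-⊗ p q))))
      (solve 4 (λ c z p q → c :* q :+ (con (+ 0) :+ z :* (p :* q)) := (c :+ z :* p) :* q)
        refl _ _ _ _))

  eval-cong : ∀ p q → (∀ i → coefficient p i R.≈ coefficient q i) → eval p ≈ eval q
  eval-cong []      []      e = refl
  eval-cong []      (d ∷ q) e = sym (trans (+-cong (trans (⟦⟧-cong (R.sym (e 0))) 0#-homo)
    (*-congˡ (sym (eval-cong [] q (e ∘ suc))))) (trans (+-identityˡ _) (zeroʳ z)))
  eval-cong (c ∷ p) []      e = trans (+-cong (trans (⟦⟧-cong (e 0)) 0#-homo)
    (*-congˡ (eval-cong p [] (e ∘ suc)))) (trans (+-identityˡ _) (zeroʳ z))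
  eval-cong (c ∷ p) (d ∷ q) e = +-cong (⟦⟧-cong (e 0)) (*-congˡ (eval-cong p q (e ∘ suc)))

  eval-constant : ∀ c → eval (constant c) ≈ φ c
  eval-constant c = trans (+-congˡ (zeroʳ z)) (+-identityʳ _)

  eval-X : eval X ≈ z
  eval-X = trans (+-cong 0#-homo (*-congˡ (trans (+-cong 1#-homo (zeroʳ z)) (+-identityʳ _))))
    (trans (+-identityˡ _) (*-identityʳ z))

module EvaluationNatural {c₁ ℓ₁ c₂ ℓ₂ c₃ ℓ₃ : Level}
  (R : CommutativeRing c₁ ℓ₁) (A : CommutativeRing c₂ ℓ₂) (B : CommutativeRing c₃ ℓ₃)
  (φ : CommutativeRing.Carrier R → CommutativeRing.Carrier A)
  (ψ : CommutativeRing.Carrier A → CommutativeRing.Carrier B)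
  (ψ-hom : IsRingHomomorphism (CommutativeRing.rawRing A) (CommutativeRing.rawRing B) ψ) where

  open CommutativeRing B
  open IsRingHomomorphism ψ-hom
  private
    module R = Polynomials (CommutativeRing.rawRing R)
    module A = Polynomials (CommutativeRing.rawRing A)
    module B = Polynomials rawRing

  evaluate-natural : ∀ p z → ψ (A.evaluate (map φ p) z) ≈ B.evaluate (map (ψ ∘ φ) p) (ψ z)
  evaluate-natural []      z = 0#-homo
  evaluate-natural (c ∷ p) z =
    trans (+-homo _ _) (+-congˡ (trans (*-homo _ _) (*-congˡ (evaluate-natural p z))))

module _ {c ℓ : Level} (R : CommutativeRing c ℓ) where

  open CommutativeRing R
  open Polynomials rawRing

  evaluate-cong : ∀ p {z w} → z ≈ w → evaluate p z ≈ evaluate p w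
  evaluate-cong []      e = refl
  evaluate-cong (c ∷ p) e = +-congˡ (*-cong e (evaluate-cong p e))

-- The recurrence solved for multiplication by x

module D'ArcaisRecurrence {ℓ c′ ℓ′ : Level} (ℝ : CompleteOrderedField ℓ) (A : CommutativeRing c′ ℓ′)
  (φ : CompleteOrderedField.Carrier ℝ → CommutativeRing.Carrier A)
  (φ-hom : IsRingHomomorphism (CompleteOrderedField.rawRing ℝ) (CommutativeRing.rawRing A) φ)
  (h : ℕ → CompleteOrderedField.Carrier ℝ)
  (h≉0 : ∀ n → ¬ CompleteOrderedField._≈_ ℝ (h (suc n)) (CompleteOrderedField.0# ℝ))
  (x : CommutativeRing.Carrier A) where

  private module ℝ = CompleteOrderedField ℝ
  open CommutativeRing A
  open PowerSeries A
  open IsRingHomomorphism φ-hom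
  open IntegerMultiples A using (solve; con; _:=_; _:+_; _:*_; _:-_; :-_)
  open IntegerMultiples ℝ.commutativeRing using (ι; ι-isRingHomomorphism)
  open Polynomials ℝ.rawRing using (_·_; _⊗_; X; constant)
  open D'Arcais ℝ
  open Evaluation ℝ.commutativeRing A φ φ-hom (- x)
  open import Relation.Binary.Reasoning.Setoid setoid
  open SeriesHomomorphism ℤ.+-*-commutativeRing A (φ ∘ ι)
    (Composition.isRingHomomorphism trans ι-isRingHomomorphism φ-hom)
  open IsRingHomomorphism (Composition.isRingHomomorphism trans ι-isRingHomomorphism φ-hom)
    using () renaming (+-homo to φι-+; *-homo to φι-*; 1#-homo to φι-1; 0#-homo to φι-0)

  p : Series
  p m = eval (P h m)

  s : Series
  s k = φ (ι (+ σ (suc k)))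

  f d : Series
  f = φ ∘ ι ∘ DivisorSeries.f
  d = φ ∘ ι ∘ DivisorSeries.d

  y : Series
  y m = sgn m * p m

  -- Without the constant `y 0`, `row` says that `v` is an eigenvector for x of the infinite
  -- Hessenberg matrix with entries h (m+2) above the diagonal and `M m i` for i ≤ m. A zero of P of
  -- index n cuts off a finite eigenvector of length n - 1 or less in these indices.
  v : Series
  v m = y (suc m)

  eval-· : ∀ n q → eval (n · q) ≈ φ (ι (+ n)) * eval q
  eval-· zero    q = sym (trans (*-congʳ φι-0) (zeroˡ _))
  eval-· (suc n) q = trans (eval-⊕ q (n · q)) (trans (+-congˡ (eval-· n q))
    (trans (solve 2 (λ a n → a :+ n :* a := (con (+ 1) :+ n) :* a) refl _ _)
      (*-congʳ (trans (+-congʳ (sym φι-1)) (sym (φι-+ (+ 1) (+ n)))))))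

  eval-convolution : ∀ j m → eval (convolution h j (suc m)) ≈ ((λ i → s (j ℕ.+ i)) ⋆ p) m
  eval-convolution j zero    = trans (eval-⊕ (σ (suc j) · P h 0) []) (trans (+-identityʳ _)
    (trans (eval-· (σ (suc j)) (P h 0)) (*-congʳ (reflexive (≡.cong s (≡.sym (ℕ.+-identityʳ j)))))))
  eval-convolution j (suc m) = trans (eval-⊕ (σ (suc j) · P h (suc m)) _)
    (+-cong (trans (eval-· (σ (suc j)) (P h (suc m)))
              (*-congʳ (reflexive (≡.cong s (≡.sym (ℕ.+-identityʳ j))))))
      (trans (eval-convolution (suc j) m)
        (⋆-cong (λ i → reflexive (≡.cong s (≡.sym (ℕ.+-suc j i)))) (λ _ → refl) m)))

  p-recurrence : ∀ m → φ (h (suc m)) * p (suc m) ≈ - x * (s ⋆ p) m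
  p-recurrence m = begin
    φ (h (suc m)) * p (suc m)
      ≈⟨ *-congˡ (trans (eval-⊗ (X ⊗ constant (h (suc m) ℝ.⁻¹)) (convolution h 0 (suc m)))
           (*-cong (trans (eval-⊗ X (constant (h (suc m) ℝ.⁻¹)))
                          (*-cong eval-X (eval-constant (h (suc m) ℝ.⁻¹))))
                   (eval-convolution 0 m))) ⟩
    φ (h (suc m)) * (- x * φ (h (suc m) ℝ.⁻¹) * (s ⋆ p) m)
      ≈⟨ solve 4 (λ a b x q → a :* (:- x :* b :* q) := a :* b :* (:- x :* q)) refl _ _ _ _ ⟩
    φ (h (suc m)) * φ (h (suc m) ℝ.⁻¹) * (- x * (s ⋆ p) m)
      ≈⟨ *-congʳ (trans (sym (*-homo _ _)) (trans (⟦⟧-cong (ℝ.*-inverseʳ (h≉0 m))) 1#-homo)) ⟩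
    1# * (- x * (s ⋆ p) m)
      ≈⟨ *-identityˡ _ ⟩
    - x * (s ⋆ p) m ∎

  -- One sign of `sgn (suc m)` cancels that of the point -x; the others are spread over the
  -- convolution by `sgn-⋆` and turn σ into the alternating `f`.
  y-recurrence : ∀ m → φ (h (suc m)) * v m ≈ x * (f ⋆ y) m
  y-recurrence m = begin
    φ (h (suc m)) * (- sgn m * p (suc m))
      ≈⟨ solve 3 (λ a s q → a :* (:- s :* q) := :- s :* (a :* q)) refl _ _ _ ⟩
    - sgn m * (φ (h (suc m)) * p (suc m))
      ≈⟨ *-congˡ (p-recurrence m) ⟩
    - sgn m * (- x * (s ⋆ p) m)
      ≈⟨ solve 3 (λ x s q → :- s :* (:- x :* q) := x :* (s :* q)) refl _ _ _ ⟩
    x * (sgn m * (s ⋆ p) m)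
      ≈⟨ *-congˡ (sgn-⋆ s p m) ⟨
    x * ((λ i → sgn i * s i) ⋆ y) m
      ≈⟨ *-congˡ (⋆-cong (λ i → trans (φι-* (DivisorSeries.sgn i) (+ σ (suc i))) (*-congʳ (sgn-homo i)))
                         (λ _ → refl) m) ⟨
    x * (f ⋆ y) m ∎

  d⋆f : d ⋆ f ≋ unit
  d⋆f n = trans (sym (⋆-homo DivisorSeries.d DivisorSeries.f n))
    (trans (reflexive (≡.cong (φ ∘ ι) (DivisorSeries.d⋆f n))) (unit-homo n))

  -- As an identity of series, `y-recurrence` equates the weighted `v` with x f y; multiplying by d
  -- = 1/f isolates x y.
  x*y : ∀ n → x * y n ≈ (d ⋆ (λ k → φ (h (suc k)) * v k)) n
  x*y n = begin
    x * y n                                  ≈⟨ *-congˡ (⋆-identityˡ y n) ⟨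
    x * (unit ⋆ y) n                         ≈⟨ *-congˡ (⋆-cong d⋆f (λ _ → refl) n) ⟨
    x * ((d ⋆ f) ⋆ y) n                      ≈⟨ *-congˡ (⋆-assoc d f y n) ⟩
    x * (d ⋆ (f ⋆ y)) n                      ≈⟨ ⋆-scaleʳ x d (f ⋆ y) n ⟨
    (d ⋆ (λ k → x * (f ⋆ y) k)) n            ≈⟨ ⋆-cong (λ _ → refl) y-recurrence n ⟨
    (d ⋆ (λ k → φ (h (suc k)) * v k)) n      ∎

  M : ℕ → ℕ → ℝ.Carrier
  M m i = ι (DivisorSeries.d (suc m ℕ.∸ i)) ℝ.* h (suc i)

  initial : φ (h 1) * v 0 ≈ x
  initial = begin
    φ (h 1) * v 0    ≈⟨ y-recurrence 0 ⟩
    x * (f 0 * y 0)  ≈⟨ *-congˡ (*-cong φι-1 (trans (*-identityˡ _)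
                          (trans (eval-constant ℝ.1#) 1#-homo))) ⟩
    x * (1# * 1#)    ≈⟨ solve 1 (λ x → x :* (con (+ 1) :* con (+ 1)) := x) refl x ⟩
    x                ∎

  row : ∀ m → x * v m ≈ φ (h (2 ℕ.+ m)) * v (suc m) + sum< (suc m) (λ i → φ (M m i) * v i)
  row m = begin
    x * v m
      ≈⟨ trans (x*y (suc m)) (⋆-sum d (λ k → φ (h (suc k)) * v k) (suc m)) ⟩
    sum< (suc m) (λ i → d (suc m ℕ.∸ i) * (φ (h (suc i)) * v i))
      + d (m ℕ.∸ m) * (φ (h (2 ℕ.+ m)) * v (suc m))
      ≈⟨ +-cong (sum<-cong (suc m) (λ _ → trans (sym (*-assoc _ _ _)) (*-congʳ (sym (*-homo _ _)))))
           (trans (*-congʳ (trans (reflexive (≡.cong d (ℕ.n∸n≡0 m))) φι-1)) (*-identityˡ _)) ⟩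
    sum< (suc m) (λ i → φ (M m i) * v i) + φ (h (2 ℕ.+ m)) * v (suc m)
      ≈⟨ +-comm _ _ ⟩
    φ (h (2 ℕ.+ m)) * v (suc m) + sum< (suc m) (λ i → φ (M m i) * v i) ∎

-- Inequalities in an ordered field

module OrderedField {ℓ : Level} (ℝ : CompleteOrderedField ℓ) where

  open CompleteOrderedField ℝ
  open SquareRoot ℝ public
    using (compare; <-trans; <-irrefl; <-respˡ; <-respʳ; 0≤x*x; 0≤x+y)
  open IntegerMultiples commutativeRing using (ι; solve; con; _:=_; _:+_; _:*_; _:-_; :-_)
  open import Algebra.Properties.Ring ring using (-0#≈0#)

  private
    strictTotalOrder : StrictTotalOrder ℓ ℓ ℓ
    strictTotalOrder = record { isStrictTotalOrder = isStrictTotalOrder }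
    module NonStrict = StrictToNonStrict _≈_ _<_

  open StrictTotalOrderProperties strictTotalOrder public
    using () renaming (refl to ≤-refl; trans to ≤-trans; antisym to ≤-antisym
      ; ≤-respˡ-≈ to ≤-respˡ; ≤-respʳ-≈ to ≤-respʳ; reflexive to ≤-reflexive)

  ≤-<-trans : ∀ {x y z} → x ≤ y → y < z → x < z
  ≤-<-trans = NonStrict.≤-<-trans sym <-trans <-respˡ

  <-≤-trans : ∀ {x y z} → x < y → y ≤ z → x < z
  <-≤-trans = NonStrict.<-≤-trans <-trans <-respʳ

  ≮⇒≥ : ∀ {x y} → ¬ x < y → y ≤ x
  ≮⇒≥ {x} {y} x≮y with compare x y
  ... | tri< x<y _ _ = contradiction x<y x≮y
  ... | tri≈ _ x≈y _ = inj₂ (sym x≈y)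
  ... | tri> _ _ y<x = inj₁ y<x

  ≰⇒> : ∀ {x y} → ¬ x ≤ y → y < x
  ≰⇒> {x} {y} x≰y with compare x y
  ... | tri< x<y _ _ = contradiction (inj₁ x<y) x≰y
  ... | tri≈ _ x≈y _ = contradiction (inj₂ x≈y) x≰y
  ... | tri> _ _ y<x = y<x

  ≤⇒≯ : ∀ {x y} → x ≤ y → ¬ y < x
  ≤⇒≯ x≤y y<x = <-irrefl refl (≤-<-trans x≤y y<x)

  x<y⇒0<y-x : ∀ {x y} → x < y → 0# < y - x
  x<y⇒0<y-x {x} {y} x<y = <-respˡ (-‿inverseˡ x) (<-respʳ (+-comm _ _) (+-monoʳ-< (- x) x<y))

  0<y-x⇒x<y : ∀ {x y} → 0# < y - x → x < y
  0<y-x⇒x<y {x} {y} p = <-respˡ (+-identityʳ x)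
    (<-respʳ (solve 2 (λ x y → x :+ (y :- x) := y) refl x y) (+-monoʳ-< x p))

  x≤y⇒0≤y-x : ∀ {x y} → x ≤ y → 0# ≤ y - x
  x≤y⇒0≤y-x (inj₁ x<y) = inj₁ (x<y⇒0<y-x x<y)
  x≤y⇒0≤y-x (inj₂ x≈y) = inj₂ (trans (sym (-‿inverseʳ _)) (+-congʳ x≈y))

  0≤y-x⇒x≤y : ∀ {x y} → 0# ≤ y - x → x ≤ y
  0≤y-x⇒x≤y (inj₁ p) = inj₁ (0<y-x⇒x<y p)
  0≤y-x⇒x≤y {x} {y} (inj₂ p) = inj₂ (trans (solve 2 (λ x y → x := y :- (y :- x)) refl x y)
    (trans (+-congˡ (trans (-‿cong (sym p)) -0#≈0#)) (+-identityʳ y)))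

  -- With `nonNeg⇒≤`, the pattern for most inequalities below: an evidently positive expression is
  -- given, and the solver identifies it with the difference of the two sides.
  pos⇒< : ∀ {x y d} → 0# < d → d ≈ y - x → x < y
  pos⇒< p e = 0<y-x⇒x<y (<-respʳ e p)

  nonNeg⇒≤ : ∀ {x y d} → 0# ≤ d → d ≈ y - x → x ≤ y
  nonNeg⇒≤ p e = 0≤y-x⇒x≤y (≤-respʳ e p)

  +-pos-nonNeg : ∀ {x y} → 0# < x → 0# ≤ y → 0# < x + y
  +-pos-nonNeg {x} {y} p (inj₁ q) = <-trans p (<-respˡ (+-identityʳ x) (+-monoʳ-< x q))
  +-pos-nonNeg {x} {y} p (inj₂ q) = <-respʳ (trans (sym (+-identityʳ x)) (+-congˡ q)) p

  +-nonNeg-pos : ∀ {x y} → 0# ≤ x → 0# < y → 0# < x + y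
  +-nonNeg-pos p q = <-respʳ (+-comm _ _) (+-pos-nonNeg q p)

  *-nonNeg : ∀ {x y} → 0# ≤ x → 0# ≤ y → 0# ≤ x * y
  *-nonNeg (inj₁ p) (inj₁ q) = inj₁ (*-pos p q)
  *-nonNeg (inj₁ p) (inj₂ q) = inj₂ (sym (trans (*-congˡ (sym q)) (zeroʳ _)))
  *-nonNeg (inj₂ p) _        = inj₂ (sym (trans (*-congʳ (sym p)) (zeroˡ _)))

  +-mono-≤ : ∀ {x y u v} → x ≤ y → u ≤ v → x + u ≤ y + v
  +-mono-≤ {x} {y} {u} {v} p q = nonNeg⇒≤ (0≤x+y (x≤y⇒0≤y-x p) (x≤y⇒0≤y-x q))
    (solve 4 (λ x y u v → (y :- x) :+ (v :- u) := (y :+ v) :- (x :+ u)) refl x y u v)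

  *-monoˡ-≤ : ∀ {x y z} → 0# ≤ z → x ≤ y → z * x ≤ z * y
  *-monoˡ-≤ {x} {y} {z} p q = nonNeg⇒≤ (*-nonNeg p (x≤y⇒0≤y-x q))
    (solve 3 (λ x y z → z :* (y :- x) := z :* y :- z :* x) refl x y z)

  *-monoˡ-< : ∀ {x y z} → 0# < z → x < y → z * x < z * y
  *-monoˡ-< {x} {y} {z} p q = pos⇒< (*-pos p (x<y⇒0<y-x q))
    (solve 3 (λ x y z → z :* (y :- x) := z :* y :- z :* x) refl x y z)

  *-mono-≤ : ∀ {x y u v} → 0# ≤ u → 0# ≤ y → x ≤ y → u ≤ v → x * u ≤ y * v
  *-mono-≤ {x} {y} {u} {v} p q r s = ≤-trans
    (≤-respˡ (*-comm u x) (≤-respʳ (*-comm u y) (*-monoˡ-≤ p r))) (*-monoˡ-≤ q s)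

  *-cancelˡ-≤ : ∀ {x y z} → 0# < z → z * x ≤ z * y → x ≤ y
  *-cancelˡ-≤ p q = ≮⇒≥ λ y<x → ≤⇒≯ q (*-monoˡ-< p y<x)

  *-cancelˡ-< : ∀ {x y z} → 0# ≤ z → z * x < z * y → x < y
  *-cancelˡ-< {x} {y} p q with compare x y
  ... | tri< x<y _ _ = x<y
  ... | tri≈ _ x≈y _ = contradiction q (<-irrefl (*-congˡ x≈y))
  ... | tri> _ _ y<x = contradiction q (≤⇒≯ (*-monoˡ-≤ p (inj₁ y<x)))

  pos-cancelˡ : ∀ {x y} → 0# ≤ x → 0# < x * y → 0# < y
  pos-cancelˡ p q = *-cancelˡ-< p (<-respˡ (sym (zeroʳ _)) q)

  neg-pos : ∀ {x} → x < 0# → 0# < - x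
  neg-pos p = <-respʳ (+-identityˡ _) (x<y⇒0<y-x p)

  pos-neg : ∀ {x} → 0# < x → - x < 0#
  pos-neg {x} p = pos⇒< p (solve 1 (λ x → x := con (+ 0) :- :- x) refl x)

  square-cancel-≤ : ∀ {x y} → 0# ≤ y → x * x ≤ y * y → x ≤ y
  square-cancel-≤ {x} {y} 0≤y p = ≮⇒≥ λ y<x → ≤⇒≯ p (pos⇒<
    (*-pos (x<y⇒0<y-x y<x) (+-pos-nonNeg (≤-<-trans 0≤y y<x) 0≤y))
    (solve 2 (λ x y → (x :- y) :* (x :+ y) := x :* x :- y :* y) refl x y))

  square-cancel-< : ∀ {x y} → 0# ≤ y → x * x < y * y → x < y
  square-cancel-< 0≤y p = [ id , (λ x≈y → contradiction p (<-irrefl (*-cong x≈y x≈y))) ]′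
    (square-cancel-≤ 0≤y (inj₁ p))

  square-injective : ∀ {x y} → 0# ≤ x → 0# ≤ y → x * x ≈ y * y → x ≈ y
  square-injective p q e = ≤-antisym (square-cancel-≤ q (≤-reflexive e))
                                     (square-cancel-≤ p (≤-reflexive (sym e)))

  x²≈0⇒x≈0 : ∀ {x} → x * x ≈ 0# → x ≈ 0#
  x²≈0⇒x≈0 {x} e with compare x 0#
  ... | tri≈ _ x≈0 _ = x≈0
  ... | tri> _ _ 0<x = contradiction (*-pos 0<x 0<x) (<-irrefl (sym e))
  ... | tri< x<0 _ _ = contradiction (*-pos (neg-pos x<0) (neg-pos x<0))
    (<-irrefl (sym (trans (solve 1 (λ x → :- x :* :- x := x :* x) refl x) e)))

  0<ι : ∀ {i} → ℤ.0ℤ ℤ.< i → 0# < ι i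
  0<ι {+ suc n} (ℤ.+<+ _) = positive n
    where
    positive : ∀ n → 0# < ι (+ suc n)
    positive zero    = 0<1
    positive (suc n) = +-pos-nonNeg (positive n) (inj₁ 0<1)

-- Complex numbers and the modulus

module ComplexField {ℓ : Level} (ℝ : CompleteOrderedField ℓ) where

  private module ℝ = CompleteOrderedField ℝ
  open OrderedField ℝ
  open ComplexNumbers ℝ
  open SquareRoot ℝ using (0≤sqrt; sqrt*sqrt≈)
  open IntegerMultiples ℝ.commutativeRing using (solve; con; _:=_; _:+_; _:*_; _:-_; :-_)

  ℂ-commutativeRing : CommutativeRing ℓ ℓ
  ℂ-commutativeRing = record
    { RawRing ℂ-rawRing
    ; isCommutativeRing = record
      { isRing = record
        { +-isAbelianGroup = record
          { isGroup = record
            { isMonoid = record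
              { isSemigroup = record
                { isMagma = record
                  { isEquivalence = record
                    { refl  = ℝ.refl , ℝ.refl
                    ; sym   = λ { (p , q) → ℝ.sym p , ℝ.sym q }
                    ; trans = λ { (p , q) (r , s) → ℝ.trans p r , ℝ.trans q s } }
                  ; ∙-cong = λ { (p , q) (r , s) → ℝ.+-cong p r , ℝ.+-cong q s } }
                ; assoc = λ _ _ _ → ℝ.+-assoc _ _ _ , ℝ.+-assoc _ _ _ }
              ; identity = (λ _ → ℝ.+-identityˡ _ , ℝ.+-identityˡ _)
                         , (λ _ → ℝ.+-identityʳ _ , ℝ.+-identityʳ _) }
            ; inverse = (λ _ → ℝ.-‿inverseˡ _ , ℝ.-‿inverseˡ _)
                      , (λ _ → ℝ.-‿inverseʳ _ , ℝ.-‿inverseʳ _)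
            ; ⁻¹-cong = λ { (p , q) → ℝ.-‿cong p , ℝ.-‿cong q } }
          ; comm = λ _ _ → ℝ.+-comm _ _ , ℝ.+-comm _ _ }
        ; *-cong = λ { (p , q) (r , s) → ℝ.+-cong (ℝ.*-cong p r) (ℝ.-‿cong (ℝ.*-cong q s))
                                       , ℝ.+-cong (ℝ.*-cong p s) (ℝ.*-cong q r) }
        ; *-assoc = λ _ _ _ →
            solve 6 (λ a b c d e f → (a :* c :- b :* d) :* e :- (a :* d :+ b :* c) :* f
              := a :* (c :* e :- d :* f) :- b :* (c :* f :+ d :* e)) ℝ.refl _ _ _ _ _ _
          , solve 6 (λ a b c d e f → (a :* c :- b :* d) :* f :+ (a :* d :+ b :* c) :* e
              := a :* (c :* f :+ d :* e) :+ b :* (c :* e :- d :* f)) ℝ.refl _ _ _ _ _ _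
        ; *-identity =
            (λ _ → solve 2 (λ a b → con (+ 1) :* a :- con (+ 0) :* b := a) ℝ.refl _ _
                 , solve 2 (λ a b → con (+ 1) :* b :+ con (+ 0) :* a := b) ℝ.refl _ _)
          , (λ _ → solve 2 (λ a b → a :* con (+ 1) :- b :* con (+ 0) := a) ℝ.refl _ _
                 , solve 2 (λ a b → a :* con (+ 0) :+ b :* con (+ 1) := b) ℝ.refl _ _)
        ; distrib =
            (λ _ _ _ → solve 6 (λ a b c d e f → a :* (c :+ e) :- b :* (d :+ f)
                         := (a :* c :- b :* d) :+ (a :* e :- b :* f)) ℝ.refl _ _ _ _ _ _
                     , solve 6 (λ a b c d e f → a :* (d :+ f) :+ b :* (c :+ e)
                         := (a :* d :+ b :* c) :+ (a :* f :+ b :* e)) ℝ.refl _ _ _ _ _ _)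
          , (λ _ _ _ → solve 6 (λ a b c d e f → (c :+ e) :* a :- (d :+ f) :* b
                         := (c :* a :- d :* b) :+ (e :* a :- f :* b)) ℝ.refl _ _ _ _ _ _
                     , solve 6 (λ a b c d e f → (c :+ e) :* b :+ (d :+ f) :* a
                         := (c :* b :+ d :* a) :+ (e :* b :+ f :* a)) ℝ.refl _ _ _ _ _ _) }
      ; *-comm = λ _ _ →
          solve 4 (λ a b c d → a :* c :- b :* d := c :* a :- d :* b) ℝ.refl _ _ _ _
        , solve 4 (λ a b c d → a :* d :+ b :* c := c :* b :+ d :* a) ℝ.refl _ _ _ _ } }

  private module C = CommutativeRing ℂ-commutativeRing

  ofReal-isRingHomomorphism : IsRingHomomorphism ℝ.rawRing C.rawRing ofReal
  ofReal-isRingHomomorphism = isRingHomomorphism ℝ.commutativeRing ℂ-commutativeRing ofReal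
    (λ e → e , ℝ.refl)
    (λ _ _ → ℝ.refl , ℝ.sym (ℝ.+-identityˡ _))
    (λ x y → solve 2 (λ x y → x :* y := x :* y :- con (+ 0) :* con (+ 0)) ℝ.refl x y
           , solve 2 (λ x y → con (+ 0) := x :* con (+ 0) :+ con (+ 0) :* y) ℝ.refl x y)
    C.refl C.refl
    (λ _ → ℝ.refl , solve 0 (con (+ 0) := :- con (+ 0)) ℝ.refl)

  open ℝ using (_≈_; _≤_; _<_; _+_; _*_; _-_; -_; 0#; refl; sym; trans; *-cong; +-cong)

  normSquared : ℂ → ℝ.Carrier
  normSquared z = re z * re z + im z * im z

  0≤modulus : ∀ z → 0# ≤ modulus z
  0≤modulus z = 0≤sqrt (normSquared z) (0≤x+y (0≤x*x (re z)) (0≤x*x (im z)))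

  modulus² : ∀ z → modulus z * modulus z ≈ normSquared z
  modulus² z = sqrt*sqrt≈ (normSquared z) (0≤x+y (0≤x*x (re z)) (0≤x*x (im z)))

  modulus-unique : ∀ {r} z → 0# ≤ r → r * r ≈ normSquared z → modulus z ≈ r
  modulus-unique z 0≤r e = square-injective (0≤modulus z) 0≤r (trans (modulus² z) (sym e))

  modulus-cong : ∀ {z w} → z C.≈ w → modulus z ≈ modulus w
  modulus-cong {z} {w} (p , q) = modulus-unique z (0≤modulus w)
    (trans (modulus² w) (+-cong (*-cong (sym p) (sym p)) (*-cong (sym q) (sym q))))

  modulus-neg : ∀ z → modulus (C.- z) ≈ modulus z
  modulus-neg z = modulus-unique (C.- z) (0≤modulus z) (trans (modulus² z)
    (solve 2 (λ a b → a :* a :+ b :* b := :- a :* :- a :+ :- b :* :- b) refl (re z) (im z)))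

  modulus-* : ∀ z w → modulus (z C.* w) ≈ modulus z * modulus w
  modulus-* z w = modulus-unique (z C.* w) (*-nonNeg (0≤modulus z) (0≤modulus w))
    (trans (solve 2 (λ m n → m :* n :* (m :* n) := m :* m :* (n :* n)) refl _ _)
    (trans (*-cong (modulus² z) (modulus² w))
      -- The two-squares identity of Brahmagupta and Fibonacci.
      (solve 4 (λ a b c d → (a :* a :+ b :* b) :* (c :* c :+ d :* d)
        := (a :* c :- b :* d) :* (a :* c :- b :* d) :+ (a :* d :+ b :* c) :* (a :* d :+ b :* c))
        refl _ _ _ _)))

  modulus-ofReal : ∀ {x} → 0# ≤ x → modulus (ofReal x) ≈ x
  modulus-ofReal {x} 0≤x = modulus-unique (ofReal x) 0≤x
    (solve 1 (λ x → x :* x := x :* x :+ con (+ 0) :* con (+ 0)) refl x)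

  re≤modulus : ∀ z → re z ≤ modulus z
  re≤modulus z = square-cancel-≤ (0≤modulus z) (nonNeg⇒≤ (0≤x*x (im z))
    (trans (solve 2 (λ a b → b :* b := a :* a :+ b :* b :- a :* a) refl (re z) (im z))
      (ℝ.+-congʳ (sym (modulus² z)))))

  modulus-+ : ∀ z w → modulus (z C.+ w) ≤ modulus z + modulus w
  modulus-+ z w = square-cancel-≤ (0≤x+y (0≤modulus z) (0≤modulus w)) (nonNeg⇒≤
    (0≤x+y (x≤y⇒0≤y-x dot≤) (x≤y⇒0≤y-x dot≤))
    (trans (solve 6 (λ a b c d m n →
        (m :* n :- (a :* c :+ b :* d)) :+ (m :* n :- (a :* c :+ b :* d))
        := (a :* a :+ b :* b) :+ (c :* c :+ d :* d) :+ (m :* n :+ m :* n)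
           :- ((a :+ c) :* (a :+ c) :+ (b :+ d) :* (b :+ d)))
        refl (re z) (im z) (re w) (im w) (modulus z) (modulus w))
      (+-cong (trans (ℝ.+-congʳ (+-cong (sym (modulus² z)) (sym (modulus² w))))
          (solve 2 (λ m n → m :* m :+ n :* n :+ (m :* n :+ m :* n) := (m :+ n) :* (m :+ n))
            refl (modulus z) (modulus w)))
        (ℝ.-‿cong (sym (modulus² (z C.+ w)))))))
    where
    -- Cauchy-Schwarz in the plane, by Lagrange's identity: the difference of the squares is (ad -
    -- bc)².
    dot≤ : re z * re w + im z * im w ≤ modulus z * modulus w
    dot≤ = square-cancel-≤ (*-nonNeg (0≤modulus z) (0≤modulus w)) (nonNeg⇒≤
      (0≤x*x (re z * im w - im z * re w))
      (trans (solve 4 (λ a b c d → (a :* d :- b :* c) :* (a :* d :- b :* c)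
          := (a :* a :+ b :* b) :* (c :* c :+ d :* d)
             :- (a :* c :+ b :* d) :* (a :* c :+ b :* d)) refl (re z) (im z) (re w) (im w))
        (ℝ.+-congʳ (trans (*-cong (sym (modulus² z)) (sym (modulus² w)))
          (solve 2 (λ m n → m :* m :* (n :* n) := m :* n :* (m :* n)) refl _ _)))))

  re≈modulus⇒real : ∀ {z} → re z ≈ modulus z → z C.≈ ofReal (modulus z)
  re≈modulus⇒real {z} e = e , x²≈0⇒x≈0 (trans
    (solve 2 (λ a b → b :* b := a :* a :+ b :* b :- a :* a) refl (re z) (im z))
    (trans (+-cong (sym (modulus² z)) (ℝ.-‿cong (*-cong e e))) (ℝ.-‿inverseʳ _)))

  -- |z - c|² - (|z| - c)² = 2 c (|z| - Re z), which is positive unless z is its own modulus. The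
  -- number |z| - c may be negative; `square-cancel-<` permits this.
  modulus<modulus-c+c : ∀ {c} z → 0# < c → ¬ z C.≈ ofReal (modulus z) →
    modulus z < modulus (z C.- ofReal c) + c
  modulus<modulus-c+c {c} z 0<c z≉ = 0<y-x⇒x<y (<-respʳ
    (solve 3 (λ n m c → n :- (m :- c) := n :+ c :- m) refl (modulus (z C.- ofReal c)) (modulus z) c)
    (x<y⇒0<y-x m-c<))
    where
    re<modulus : re z < modulus z
    re<modulus = [ id , (λ e → contradiction (re≈modulus⇒real e) z≉) ]′ (re≤modulus z)

    m-c< : modulus z - c < modulus (z C.- ofReal c)
    m-c< = square-cancel-< (0≤modulus _) (pos⇒<
      (ℝ.*-pos (+-pos-nonNeg 0<c (inj₁ 0<c)) (x<y⇒0<y-x re<modulus))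
      (trans (solve 4 (λ c a b m → (c :+ c) :* (m :- a)
          := (a :- c) :* (a :- c) :+ (b :+ :- con (+ 0)) :* (b :+ :- con (+ 0))
             :- ((m :- c) :* (m :- c) :+ (a :* a :+ b :* b :- m :* m)))
          refl c (re z) (im z) (modulus z))
        (+-cong (sym (modulus² (z C.- ofReal c))) (ℝ.-‿cong
          (trans (ℝ.+-congˡ (trans (ℝ.+-congʳ (sym (modulus² z))) (ℝ.-‿inverseʳ _)))
                 (ℝ.+-identityʳ _))))))

-- Largest roots of locally Lipschitz functions

module RealContinuity {ℓ : Level} (ℝ : CompleteOrderedField ℓ) where

  open CompleteOrderedField ℝ
  open OrderedField ℝ
  open ComplexNumbers ℝ
  open ComplexField ℝ
  open Polynomials rawRing
  open IntegerMultiples commutativeRing using (solve; con; _:=_; _:+_; _:*_; _:-_; :-_)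
  open IsRingHomomorphism ofReal-isRingHomomorphism
  private module C = CommutativeRing ℂ-commutativeRing

  opaque
    -- Taken from the complex modulus so that its laws are inherited; opaque, so that the square
    -- root does not unfold.
    abs : Carrier → Carrier
    abs x = modulus (ofReal x)

    0≤abs : ∀ x → 0# ≤ abs x
    0≤abs x = 0≤modulus (ofReal x)

    abs-cong : ∀ {x y} → x ≈ y → abs x ≈ abs y
    abs-cong e = modulus-cong (⟦⟧-cong e)

    abs-neg : ∀ x → abs (- x) ≈ abs x
    abs-neg x = trans (modulus-cong (-‿homo x)) (modulus-neg (ofReal x))

    abs-* : ∀ x y → abs (x * y) ≈ abs x * abs y
    abs-* x y = trans (modulus-cong (*-homo x y)) (modulus-* (ofReal x) (ofReal y))

    abs-+ : ∀ x y → abs (x + y) ≤ abs x + abs y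
    abs-+ x y = ≤-respˡ (modulus-cong (C.sym (+-homo x y))) (modulus-+ (ofReal x) (ofReal y))

    abs-nonNeg : ∀ {x} → 0# ≤ x → abs x ≈ x
    abs-nonNeg = modulus-ofReal

    x≤abs : ∀ x → x ≤ abs x
    x≤abs x = re≤modulus (ofReal x)

    -δ≤x≤δ⇒abs≤ : ∀ {x δ} → 0# ≤ δ → - δ ≤ x → x ≤ δ → abs x ≤ δ
    -δ≤x≤δ⇒abs≤ {x} {δ} 0≤δ p q = square-cancel-≤ 0≤δ (nonNeg⇒≤
      (*-nonNeg (x≤y⇒0≤y-x p) (x≤y⇒0≤y-x q))
      (trans (solve 2 (λ x d → (x :- :- d) :* (d :- x) := d :* d :- (x :* x :+ con (+ 0) :* con (+ 0)))
        refl x δ) (+-congˡ (-‿cong (sym (modulus² (ofReal x)))))))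

  -- A bound on the fixed neighbourhood of radius 1 stands in for continuity: the constant for a
  -- polynomial is computed along Horner's scheme, with no nested choice of ε and δ.
  LipschitzAt : (Carrier → Carrier) → Carrier → Set ℓ
  LipschitzAt F s = ∃ λ K → 0# ≤ K × (∀ x → abs (x - s) ≤ 1# → abs (F x - F s) ≤ K * abs (x - s))

  evaluate-lipschitz : ∀ p s → LipschitzAt (evaluate p) s
  evaluate-lipschitz []      s = 0# , ≤-refl , λ x _ → ≤-reflexive (trans (abs-cong (-‿inverseʳ 0#))
    (trans (abs-nonNeg ≤-refl) (sym (zeroˡ _))))
  evaluate-lipschitz (c ∷ p) s with evaluate-lipschitz p s
  ... | K , 0≤K , bound = K * (1# + abs s) + abs (evaluate p s)
    , 0≤x+y (*-nonNeg 0≤K (0≤x+y (inj₁ 0<1) (0≤abs s))) (0≤abs _) , λ x near →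
      -- With u = p(x) and v = p(s) the increment is (u - v) x + v (x - s), and |x| ≤ 1 + |s| near
      -- s.
      ≤-respˡ (abs-cong (solve 5 (λ c x s u v → (u :- v) :* x :+ v :* (x :- s)
          := (c :+ x :* u) :- (c :+ s :* v)) refl c x s (evaluate p x) (evaluate p s)))
      (≤-trans (abs-+ _ _) (≤-respʳ
        (solve 5 (λ K o s v t → K :* t :* (o :+ s) :+ v :* t := (K :* (o :+ s) :+ v) :* t)
          refl K 1# (abs s) (abs (evaluate p s)) (abs (x - s)))
        (+-mono-≤
          (≤-respˡ (sym (abs-* _ _)) (*-mono-≤ (0≤abs x)
            (*-nonNeg 0≤K (0≤abs (x - s))) (bound x near)
            (≤-respˡ (abs-cong (solve 2 (λ x s → (x :- s) :+ s := x) refl x s))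
              (≤-trans (abs-+ _ _) (+-mono-≤ near ≤-refl)))))
          (≤-reflexive (abs-* _ _)))))

  lipschitz-reflect : ∀ {F s} → LipschitzAt F (- s) → LipschitzAt (F ∘ -_) s
  lipschitz-reflect {F} {s} (K , 0≤K , bound) = K , 0≤K , λ x near →
    ≤-respʳ (*-congˡ (reflect x)) (bound (- x) (≤-respˡ (sym (reflect x)) near))
    where
    reflect : ∀ x → abs (- x - - s) ≈ abs (x - s)
    reflect x = trans (abs-cong (solve 2 (λ x s → :- x :- :- s := :- (x :- s)) refl x s)) (abs-neg _)

  lipschitz-scale : ∀ {F s} c → LipschitzAt F s → LipschitzAt (λ x → c * F x) s
  lipschitz-scale {F} {s} c (K , 0≤K , bound) = abs c * K , *-nonNeg (0≤abs c) 0≤K , λ x near →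
    ≤-respˡ (trans (sym (abs-* _ _)) (abs-cong (distribˡ-minus x)))
      (≤-respʳ (sym (*-assoc _ _ _)) (*-monoˡ-≤ (0≤abs c) (bound x near)))
    where
    distribˡ-minus : ∀ x → c * (F x - F s) ≈ c * F x - c * F s
    distribˡ-minus x = solve 3 (λ c u v → c :* (u :- v) := c :* u :- c :* v) refl c (F x) (F s)

  stays-positive : ∀ {F s} → LipschitzAt F s → 0# < F s →
    ∃ λ δ → 0# < δ × (∀ x → abs (x - s) ≤ δ → 0# < F x)
  stays-positive {F} {s} (K , 0≤K , bound) 0<Fs = δ , 0<δ , λ x near → 0<y-x⇒x<y (<-respʳ
      (solve 2 (λ u v → u :- (u :- v) := v :- con (+ 0)) refl (F s) (F x))
      (x<y⇒0<y-x (≤-<-trans (Fs-Fx≤ x near) Kδ<Fs)))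
    where
    -- Dividing F s by F s + K + 1 meets both demands on δ at once: δ ≤ 1 and K δ < F s.
    B = F s + (K + 1#)
    0<B : 0# < B
    0<B = +-pos-nonNeg 0<Fs (0≤x+y 0≤K (inj₁ 0<1))
    B*B⁻¹ : B * B ⁻¹ ≈ 1#
    B*B⁻¹ = *-inverseʳ λ e → <-irrefl (sym e) 0<B
    0<B⁻¹ : 0# < B ⁻¹
    0<B⁻¹ = pos-cancelˡ (inj₁ 0<B) (<-respʳ (sym B*B⁻¹) 0<1)
    δ = F s * B ⁻¹
    0<δ : 0# < δ
    0<δ = *-pos 0<Fs 0<B⁻¹
    Bδ≈Fs : B * δ ≈ F s
    Bδ≈Fs = trans (solve 3 (λ b f i → b :* (f :* i) := f :* (b :* i)) refl B (F s) (B ⁻¹))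
      (trans (*-congˡ B*B⁻¹) (*-identityʳ _))
    Kδ<Fs : K * δ < F s
    Kδ<Fs = <-respʳ Bδ≈Fs (pos⇒< (*-pos (+-pos-nonNeg 0<Fs (inj₁ 0<1)) 0<δ)
      (solve 3 (λ f k d → (f :+ con (+ 1)) :* d := (f :+ (k :+ con (+ 1))) :* d :- k :* d)
        refl (F s) K δ))
    δ≤1 : δ ≤ 1#
    δ≤1 = *-cancelˡ-≤ 0<B (≤-respˡ (sym Bδ≈Fs) (nonNeg⇒≤ (0≤x+y 0≤K (inj₁ 0<1))
      (solve 2 (λ f k → k :+ con (+ 1) := (f :+ (k :+ con (+ 1))) :* con (+ 1) :- f) refl (F s) K)))
    Fs-Fx≤ : ∀ x → abs (x - s) ≤ δ → F s - F x ≤ K * δ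
    Fs-Fx≤ x near = ≤-trans (x≤abs _) (≤-respˡ
      (trans (sym (abs-neg _)) (abs-cong (solve 2 (λ u v → :- (v :- u) := u :- v) refl (F s) (F x))))
      (≤-trans (bound x (≤-trans near δ≤1)) (*-monoˡ-≤ 0≤K near)))

  module _ {F : Carrier → Carrier} {r} (lipschitz : LipschitzAt F r)
    (r-sup : IsSupremum (λ x → F x ≤ 0#) r) where

    supremum-nonPos : ¬ 0# < F r
    supremum-nonPos 0<Fr = ≤⇒≯ (proj₂ r-sup {r - δ} below)
      (pos⇒< 0<δ (solve 2 (λ r d → d := r :- (r :- d)) refl r δ))
      where
      stays = stays-positive lipschitz 0<Fr
      δ = proj₁ stays
      0<δ : 0# < δ
      0<δ = proj₁ (proj₂ stays)
      below : ∀ {x} → F x ≤ 0# → x ≤ r - δ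
      below {x} Fx≤0 = ≮⇒≥ λ r-δ<x → ≤⇒≯ Fx≤0 (proj₂ (proj₂ stays) x (-δ≤x≤δ⇒abs≤ (inj₁ 0<δ)
        (inj₁ (pos⇒< (x<y⇒0<y-x r-δ<x)
          (solve 3 (λ x r d → x :- (r :- d) := x :- r :- :- d) refl x r δ)))
        (≤-trans (nonNeg⇒≤ (x≤y⇒0≤y-x (proj₁ r-sup Fx≤0))
          (solve 2 (λ x r → r :- x := con (+ 0) :- (x :- r)) refl x r)) (inj₁ 0<δ))))

    supremum-nonNeg : ¬ F r < 0#
    supremum-nonNeg Fr<0 = ≤⇒≯ (proj₁ r-sup (inj₁ Fr+δ<0)) (pos⇒< 0<δ r+δ-r)
      where
      stays = stays-positive (lipschitz-scale (- 1#) lipschitz)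
        (<-respʳ (solve 1 (λ f → :- f := :- con (+ 1) :* f) refl (F r)) (neg-pos Fr<0))
      δ = proj₁ stays
      0<δ : 0# < δ
      0<δ = proj₁ (proj₂ stays)
      r+δ-r : δ ≈ r + δ - r
      r+δ-r = solve 2 (λ r d → d := r :+ d :- r) refl r δ
      Fr+δ<0 : F (r + δ) < 0#
      Fr+δ<0 = pos⇒< (proj₂ (proj₂ stays) (r + δ) (≤-reflexive
          (trans (abs-cong (sym r+δ-r)) (abs-nonNeg (inj₁ 0<δ)))))
        (solve 1 (λ f → :- con (+ 1) :* f := con (+ 0) :- f) refl (F (r + δ)))

    supremum-root : F r ≈ 0#
    supremum-root = ≤-antisym (≮⇒≥ supremum-nonPos) (≮⇒≥ supremum-nonNeg)

  -- The supremum is taken over F ≤ 0 rather than over the zeros: one nonpositive value then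
  -- suffices to start, and F is automatically positive beyond the root.
  largest-root : ∀ {F} → (∀ s → LipschitzAt F s) →
    (∃ λ x → F x ≤ 0#) → (∃ λ u → ∀ x → F x ≤ 0# → x ≤ u) →
    ∃ λ r → F r ≈ 0# × (∀ x → F x ≤ 0# → x ≤ r)
  largest-root {F} lipschitz inhabited (u , bounded) = proj₁ sup
    , supremum-root (lipschitz (proj₁ sup)) (proj₂ sup) , λ x → proj₁ (proj₂ sup) {x}
    where sup = supremum (λ x → F x ≤ 0#) inhabited (u , λ {x} → bounded x)

-- Dual numbers, for derivatives

module DualNumbers {c ℓ : Level} (R : CommutativeRing c ℓ) where

  open CommutativeRing R
  open IntegerMultiples R using (solve; con; _:=_; _:+_; _:*_; _:-_; :-_)

  -- R[ε] with ε² = 0, where (a , b) is a + b ε. At x + ε a polynomial takes its value and its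
  -- derivative, so ring identities differentiate themselves.
  dualRing : CommutativeRing c ℓ
  dualRing = record
    { Carrier = Carrier × Carrier
    ; _≈_ = λ { (a , b) (c , d) → a ≈ c × b ≈ d }
    ; _+_ = λ { (a , b) (c , d) → a + c , b + d }
    ; _*_ = λ { (a , b) (c , d) → a * c , a * d + b * c }
    ; -_  = λ { (a , b) → - a , - b }
    ; 0#  = 0# , 0#
    ; 1#  = 1# , 0#
    ; isCommutativeRing = record
      { isRing = record
        { +-isAbelianGroup = record
          { isGroup = record
            { isMonoid = record
              { isSemigroup = record
                { isMagma = record
                  { isEquivalence = record
                    { refl  = refl , refl
                    ; sym   = λ { (p , q) → sym p , sym q }
                    ; trans = λ { (p , q) (r , s) → trans p r , trans q s } }
                  ; ∙-cong = λ { (p , q) (r , s) → +-cong p r , +-cong q s } }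
                ; assoc = λ _ _ _ → +-assoc _ _ _ , +-assoc _ _ _ }
              ; identity = (λ _ → +-identityˡ _ , +-identityˡ _)
                         , (λ _ → +-identityʳ _ , +-identityʳ _) }
            ; inverse = (λ _ → -‿inverseˡ _ , -‿inverseˡ _)
                      , (λ _ → -‿inverseʳ _ , -‿inverseʳ _)
            ; ⁻¹-cong = λ { (p , q) → -‿cong p , -‿cong q } }
          ; comm = λ _ _ → +-comm _ _ , +-comm _ _ }
        ; *-cong = λ { (p , q) (r , s) → *-cong p r , +-cong (*-cong p s) (*-cong q r) }
        ; *-assoc = λ _ _ _ → *-assoc _ _ _
          , solve 6 (λ a b c d e f → a :* c :* f :+ (a :* d :+ b :* c) :* e
              := a :* (c :* f :+ d :* e) :+ b :* (c :* e)) refl _ _ _ _ _ _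
        ; *-identity =
            (λ _ → *-identityˡ _
                 , solve 2 (λ a b → con (+ 1) :* b :+ con (+ 0) :* a := b) refl _ _)
          , (λ _ → *-identityʳ _
                 , solve 2 (λ a b → a :* con (+ 0) :+ b :* con (+ 1) := b) refl _ _)
        ; distrib =
            (λ _ _ _ → distribˡ _ _ _
                     , solve 6 (λ a b c d e f → a :* (d :+ f) :+ b :* (c :+ e)
                         := (a :* d :+ b :* c) :+ (a :* f :+ b :* e)) refl _ _ _ _ _ _)
          , (λ _ _ _ → distribʳ _ _ _
                     , solve 6 (λ a b c d e f → (c :+ e) :* b :+ (d :+ f) :* a
                         := (c :* b :+ d :* a) :+ (e :* b :+ f :* a)) refl _ _ _ _ _ _) }
      ; *-comm = λ _ _ → *-comm _ _
        , solve 4 (λ a b c d → a :* d :+ b :* c := c :* b :+ d :* a) refl _ _ _ _ } }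

  inclusion : Carrier → Carrier × Carrier
  inclusion c = c , 0#

  inclusion-isRingHomomorphism :
    IsRingHomomorphism rawRing (CommutativeRing.rawRing dualRing) inclusion
  inclusion-isRingHomomorphism = isRingHomomorphism R dualRing inclusion
    (λ e → e , refl) (λ _ _ → refl , sym (+-identityˡ _))
    (λ x y → refl , solve 2 (λ x y → con (+ 0) := x :* con (+ 0) :+ con (+ 0) :* y) refl x y)
    (refl , refl) (refl , refl) (λ _ → refl , solve 0 (con (+ 0) := :- con (+ 0)) refl)

  proj₁-isRingHomomorphism :
    IsRingHomomorphism (CommutativeRing.rawRing dualRing) rawRing proj₁
  proj₁-isRingHomomorphism = isRingHomomorphism dualRing R proj₁
    proj₁ (λ _ _ → refl) (λ _ _ → refl) refl refl (λ _ → refl)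

  private module D = CommutativeRing dualRing

  -- Such a u is a multiple of ε. The bracketing, with `e` at the end, is that of an evaluated
  -- `q ⊗ L ^ 2`, whose power ends in the constant 1.
  infinitesimal²≈0 : ∀ {u} q e → proj₁ u ≈ 0# → (q D.* (u D.* (u D.* e))) D.≈ D.0#
  infinitesimal²≈0 {u₁ , u₂} (q₁ , q₂) (e₁ , e₂) u₁≈0 =
      vanish (q₁ * (u₁ * e₁))
        (solve 3 (λ u q e → q :* (u :* (u :* e)) := u :* (q :* (u :* e))) refl u₁ q₁ e₁)
    , vanish (q₁ * (u₁ * e₂ + u₂ * e₁ + u₂ * e₁) + q₂ * (u₁ * e₁))
        (solve 6 (λ u u′ q q′ e e′ →
          q :* (u :* (u :* e′ :+ u′ :* e) :+ u′ :* (u :* e)) :+ q′ :* (u :* (u :* e))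
          := u :* (q :* (u :* e′ :+ u′ :* e :+ u′ :* e) :+ q′ :* (u :* e)))
          refl u₁ u₂ q₁ q₂ e₁ e₂)
    where
    vanish : ∀ {x} y → x ≈ u₁ * y → x ≈ 0#
    vanish y e = trans e (trans (*-congʳ u₁≈0) (zeroˡ y))

module DualMap {c₁ ℓ₁ c₂ ℓ₂ : Level} (R : CommutativeRing c₁ ℓ₁) (S : CommutativeRing c₂ ℓ₂)
  (φ : CommutativeRing.Carrier R → CommutativeRing.Carrier S)
  (φ-hom : IsRingHomomorphism (CommutativeRing.rawRing R) (CommutativeRing.rawRing S) φ) where

  open CommutativeRing S
  open IsRingHomomorphism φ-hom
  private
    module R[ε] = DualNumbers R
    module S[ε] = DualNumbers S

  -- Needed because multiplicity concerns the complexified polynomial, while the derivative is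
  -- estimated over ℝ.
  dualMap : CommutativeRing.Carrier R[ε].dualRing → CommutativeRing.Carrier S[ε].dualRing
  dualMap (a , b) = φ a , φ b

  dualMap-isRingHomomorphism : IsRingHomomorphism (CommutativeRing.rawRing R[ε].dualRing)
    (CommutativeRing.rawRing S[ε].dualRing) dualMap
  dualMap-isRingHomomorphism = isRingHomomorphism R[ε].dualRing S[ε].dualRing dualMap
    (λ { (p , q) → ⟦⟧-cong p , ⟦⟧-cong q })
    (λ { (a , b) (c , d) → +-homo a c , +-homo b d })
    (λ { (a , b) (c , d) → *-homo a c
       , trans (+-homo _ _) (+-cong (*-homo a d) (*-homo b c)) })
    (0#-homo , 0#-homo) (1#-homo , 0#-homo)
    (λ { (a , b) → -‿homo a , -‿homo b })

-- Positive Hessenberg recurrences: comparison and largest roots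

module HessenbergRecurrence {ℓ : Level} (ℝ : CompleteOrderedField ℓ) where

  open CompleteOrderedField ℝ
  open OrderedField ℝ
  open PowerSeries commutativeRing using (Series; sum<)
  open IntegerMultiples commutativeRing using (solve; con; _:=_; _:+_; _:*_; _:-_; :-_)

  module Sums (c : Series) where

    dot-nonNeg : ∀ k {u : Series} → (∀ i → i ℕ.< k → 0# ≤ c i * u i) → 0# ≤ sum< k (λ i → c i * u i)
    dot-nonNeg zero    p = ≤-refl
    dot-nonNeg (suc k) p = 0≤x+y (dot-nonNeg k (λ i → p i ∘ ℕ.m<n⇒m<1+n)) (p k ℕ.≤-refl)

    dot-cross-≤ : ∀ k {u w : Series} {s t} → (∀ i → i ℕ.< k → 0# ≤ c i) →
      (∀ i → i ℕ.< k → u i * s ≤ t * w i) →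
      sum< k (λ i → c i * u i) * s ≤ t * sum< k (λ i → c i * w i)
    dot-cross-≤ zero    {s = s} {t} _ _ = ≤-reflexive (trans (zeroˡ s) (sym (zeroʳ t)))
    dot-cross-≤ (suc k) {u} {w} {s} {t} 0≤c p = nonNeg⇒≤
      (0≤x+y (x≤y⇒0≤y-x (dot-cross-≤ k (λ i → 0≤c i ∘ ℕ.m<n⇒m<1+n) (λ i → p i ∘ ℕ.m<n⇒m<1+n)))
             (*-nonNeg (0≤c k ℕ.≤-refl) (x≤y⇒0≤y-x (p k ℕ.≤-refl))))
      (solve 7 (λ S T c u w s t → (t :* T :- S :* s) :+ c :* (t :* w :- u :* s)
        := t :* (T :+ c :* w) :- (S :+ c :* u) :* s)
        refl (sum< k (λ i → c i * u i)) (sum< k (λ i → c i * w i)) (c k) (u k) (w k) s t)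

    dot-≤ : ∀ k {u : Series} {t} → (∀ i → i ℕ.< k → 0# ≤ c i) → (∀ i → i ℕ.< k → u i ≤ t) →
      sum< k (λ i → c i * u i) ≤ t * sum< k c
    dot-≤ zero    {t = t} _ _ = ≤-reflexive (sym (zeroʳ t))
    dot-≤ (suc k) {u} {t} 0≤c p = ≤-respʳ
      (solve 3 (λ t S c → t :* S :+ c :* t := t :* (S :+ c)) refl t (sum< k c) (c k))
      (+-mono-≤ (dot-≤ k (λ i → 0≤c i ∘ ℕ.m<n⇒m<1+n) (λ i → p i ∘ ℕ.m<n⇒m<1+n))
                (*-monoˡ-≤ (0≤c k ℕ.≤-refl) (p k ℕ.≤-refl)))

  open Sums

  IsSolution : Series → (ℕ → Series) → Carrier → Series → Set ℓ
  IsSolution a M x v = ∀ m → x * v m ≈ a (suc m) * v (suc m) + sum< (suc m) (λ i → M m i * v i)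

  module _ {a : Series} {M : ℕ → Series} (0<a : ∀ m → 0# < a m)
    (0≤M : ∀ m i → i ℕ.< suc m → 0# ≤ M m i) where

    -- The ratios N (m + 1) / N m dominate the ratios w (m + 1) / w m.
    comparison : ∀ {x} {w N : Series} → IsSolution a M x w → ∀ n →
      (∀ i → i ℕ.< n → 0# < w i) → 0# ≤ w n →
      0# < N 0 →
      (∀ m → m ℕ.< n → 0# < N m →
        x * N m < a (suc m) * N (suc m) + sum< (suc m) (λ i → M m i * N i)) →
      0# < N n
    comparison {x} {w} {N} solution n 0<w 0≤wₙ 0<N₀ strict = proj₁ (go n ℕ.≤-refl)
      where
      -- Only the last entry may vanish, as it does when `w` is taken at the largest root.
      0≤w : ∀ m → m ℕ.≤ n → 0# ≤ w m
      0≤w m m≤n = [ (λ m<n → inj₁ (0<w m m<n)) , (λ { ≡.refl → 0≤wₙ }) ]′ (ℕ.m≤n⇒m<n∨m≡n m≤n)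

      -- The invariant is N i / w i ≤ N m / w m for every i ≤ m, not only for neighbours, because
      -- the recurrence involves all earlier terms.
      go : ∀ m → m ℕ.≤ n → 0# < N m × (∀ i → i ℕ.< suc m → N i * w m ≤ N m * w i)
      go zero    _   = 0<N₀ , λ { zero _ → ≤-refl ; (suc _) (ℕ.s≤s ()) }
      go (suc m) m<n = 0<N′ , bound′
        where
        previous = go m (ℕ.<⇒≤ m<n)
        0<Nm = proj₁ previous
        bound = proj₂ previous
        0<wm = 0<w m m<n
        S T : Carrier
        S = sum< (suc m) (λ i → M m i * N i)
        T = sum< (suc m) (λ i → M m i * w i)

        -- Multiply the strict inequality for N by w m and the equation for w by N m, then subtract;
        -- the invariant gives S w m ≤ N m T, which leaves the claim times a (m+1).
        cross : N m * w (suc m) < N (suc m) * w m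
        cross = *-cancelˡ-< (inj₁ (0<a (suc m))) (pos⇒<
          (+-pos-nonNeg (*-pos 0<wm (x<y⇒0<y-x (strict m m<n 0<Nm)))
            (x≤y⇒0≤y-x (dot-cross-≤ (M m) (suc m) (0≤M m) bound)))
          (trans (solve 8 (λ x a N N′ w w′ S T →
              w :* (a :* N′ :+ S :- x :* N) :+ (N :* T :- S :* w)
              := a :* (N′ :* w) :+ N :* T :- N :* (x :* w)) refl
              x (a (suc m)) (N m) (N (suc m)) (w m) (w (suc m)) S T)
            (trans (+-congˡ (-‿cong (*-congˡ (solution m))))
              (solve 6 (λ a N N′ w w′ T → a :* (N′ :* w) :+ N :* T :- N :* (a :* w′ :+ T)
                := a :* (N′ :* w) :- a :* (N :* w′)) refl
                (a (suc m)) (N m) (N (suc m)) (w m) (w (suc m)) T))))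

        0<N′ : 0# < N (suc m)
        0<N′ = pos-cancelˡ (inj₁ 0<wm) (<-respʳ (*-comm _ _)
          (≤-<-trans (*-nonNeg (inj₁ 0<Nm) (0≤w (suc m) m<n)) cross))

        bound′ : ∀ i → i ℕ.< suc (suc m) → N i * w (suc m) ≤ N (suc m) * w i
        bound′ i (ℕ.s≤s i≤1+m) = [ earlier , (λ { ≡.refl → ≤-refl }) ]′ (ℕ.m≤n⇒m<n∨m≡n i≤1+m)
          where
          earlier : i ℕ.< suc m → N i * w (suc m) ≤ N (suc m) * w i
          earlier i<1+m = *-cancelˡ-≤ 0<wm (nonNeg⇒≤
            (0≤x+y (*-nonNeg (0≤w (suc m) m<n) (x≤y⇒0≤y-x (bound i i<1+m)))
                   (*-nonNeg (0≤w i (ℕ.≤-trans (ℕ.<⇒≤ i<1+m) m<n)) (x≤y⇒0≤y-x (inj₁ cross))))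
            (solve 6 (λ Ni N N′ wi w w′ → w′ :* (N :* wi :- Ni :* w) :+ wi :* (N′ :* w :- N :* w′)
              := w :* (N′ :* wi) :- w :* (Ni :* w′))
              refl (N i) (N m) (N (suc m)) (w i) (w m) (w (suc m))))

  open RealContinuity ℝ using (LipschitzAt; largest-root)

  module _ {a : Series} {M : ℕ → Series} (0<a : ∀ m → 0# < a m)
    (0<M : ∀ m i → i ℕ.< suc m → 0# < M m i)
    (v : Carrier → Series) (initial : ∀ x → a 0 * v x 0 ≈ x) (solution : ∀ x → IsSolution a M x (v x))
    (v-cong : ∀ m {x y} → x ≈ y → v x m ≈ v y m)
    (lipschitz : ∀ m s → LipschitzAt (λ x → v x m) s) where

    0<v₀ : ∀ {x} → 0# < x → 0# < v x 0
    0<v₀ {x} 0<x = pos-cancelˡ (inj₁ (0<a 0)) (<-respʳ (sym (initial x)) 0<x)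

    -- If v n is positive and dominates the earlier terms, then a v (n+1) ≥ (x - T) v n, where T is
    -- the row sum; so v (n+1) ≥ v n once x ≥ T + a. This bounds the set v ≤ 0 above without degrees
    -- or leading coefficients.
    eventually-increasing : ∀ n → ∃ λ R → 0# ≤ R ×
      (∀ x → R < x → 0# < v x n × (∀ i → i ℕ.< suc n → v x i ≤ v x n))
    eventually-increasing zero    = 0# , ≤-refl , λ x 0<x →
      0<v₀ 0<x , λ { zero _ → ≤-refl ; (suc _) (ℕ.s≤s ()) }
    eventually-increasing (suc n) = R + (T + a (suc n)) , 0≤x+y 0≤R 0≤T+a , λ x R′<x →
      let 0<vₙ , v≤vₙ = increasing x (≤-<-trans
            (≤-respˡ (+-identityʳ R) (+-mono-≤ ≤-refl 0≤T+a)) R′<x)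
          vₙ≤v : v x n ≤ v x (suc n)
          vₙ≤v = *-cancelˡ-≤ (0<a (suc n)) (nonNeg⇒≤
            (0≤x+y (*-nonNeg (0≤x+y (x≤y⇒0≤y-x (inj₁ R′<x)) 0≤R) (inj₁ 0<vₙ))
                   (x≤y⇒0≤y-x (dot-≤ (M n) (suc n) (λ i → inj₁ ∘ 0<M n i) v≤vₙ)))
            (trans (solve 6 (λ x R T a u S → (x :- (R :+ (T :+ a)) :+ R) :* u :+ (u :* T :- S)
                := x :* u :- S :- a :* u) refl x R T (a (suc n)) (v x n)
                (sum< (suc n) (λ i → M n i * v x i)))
              (+-congʳ (trans (+-congʳ (solution x n))
                (solve 2 (λ u S → u :+ S :- S := u) refl (a (suc n) * v x (suc n)) _)))))
      in <-≤-trans 0<vₙ vₙ≤v , λ i i<2+n →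
           [ (λ i<1+n → ≤-trans (v≤vₙ i i<1+n) vₙ≤v) , (λ { ≡.refl → ≤-refl }) ]′
             (ℕ.m<1+n⇒m<n∨m≡n i<2+n)
      where
      R = proj₁ (eventually-increasing n)
      0≤R = proj₁ (proj₂ (eventually-increasing n))
      increasing = proj₂ (proj₂ (eventually-increasing n))
      T = sum< (suc n) (M n)
      sum-nonNeg : ∀ k → (∀ i → i ℕ.< k → 0# < M n i) → 0# ≤ sum< k (M n)
      sum-nonNeg zero    p = ≤-refl
      sum-nonNeg (suc k) p = 0≤x+y (sum-nonNeg k (λ i → p i ∘ ℕ.m<n⇒m<1+n)) (inj₁ (p k ℕ.≤-refl))
      0≤T+a : 0# ≤ T + a (suc n)
      0≤T+a = 0≤x+y (sum-nonNeg (suc n) (0<M n)) (inj₁ (0<a (suc n)))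

    -- In the application `v x (suc n)` belongs to P of index n + 2, so counting starts at the
    -- smallest index of the theorem. The bound r ≤ x in `0<below` includes the root, where
    -- `comparison` is applied for simplicity.
    record IsLargestRoot (n : ℕ) (r : Carrier) : Set ℓ where
      field
        0<root      : 0# < r
        root        : v r (suc n) ≈ 0#
        0<below     : ∀ i → i ℕ.< suc n → ∀ x → r ≤ x → 0# < v x i
        0<beyond    : ∀ x → r < x → 0# < v x (suc n)

    open IsLargestRoot

    -- The root is kept strictly above the earlier ones: at a root r of v (n + 1) the
    -- recurrence gives a (n + 2) v (n + 2) = - Σ_{i≤n} M i v i < 0.
    largestRoot : ∀ n → ∃ (IsLargestRoot n)
    largestRoot zero    = M 0 0 , record
      { 0<root  = 0<M 0 0 ℕ.z<s
      ; root    = ≤-antisym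
          (*-cancelˡ-≤ (0<a 1) (≤-reflexive (trans (a₁v₁ _) (at-root _))))
          (*-cancelˡ-≤ (0<a 1) (≤-reflexive (sym (trans (a₁v₁ _) (at-root _)))))
      ; 0<below = λ { zero _ x r≤x → 0<v₀ (<-≤-trans (0<M 0 0 ℕ.z<s) r≤x) ; (suc _) (ℕ.s≤s ()) }
      ; 0<beyond = λ x r<x → pos-cancelˡ (inj₁ (0<a 1)) (<-respʳ (sym (a₁v₁ x))
          (*-pos (x<y⇒0<y-x r<x) (0<v₀ (<-trans (0<M 0 0 ℕ.z<s) r<x))))
      }
      where
      a₁v₁ : ∀ x → a 1 * v x 1 ≈ (x - M 0 0) * v x 0
      a₁v₁ x = trans (solve 3 (λ u m w → u := u :+ (con (+ 0) :+ m :* w) :- m :* w)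
          refl (a 1 * v x 1) (M 0 0) (v x 0))
        (trans (+-congʳ (sym (solution x 0)))
          (solve 3 (λ x m w → x :* w :- m :* w := (x :- m) :* w) refl x (M 0 0) (v x 0)))
      at-root : ∀ t → (M 0 0 - M 0 0) * t ≈ a 1 * 0#
      at-root t = solve 3 (λ m t a → (m :- m) :* t := a :* con (+ 0)) refl (M 0 0) t (a 1)
    largestRoot (suc n) = r′ , record
      { 0<root  = <-trans (0<root isRoot) r<r′
      ; root    = r′-root
      ; 0<below = λ i i<2+n x r′≤x →
          [ (λ i<1+n → 0<below isRoot i i<1+n x (≤-trans (inj₁ r<r′) r′≤x))
          , (λ { ≡.refl → 0<beyond isRoot x (<-≤-trans r<r′ r′≤x) }) ]′ (ℕ.m<1+n⇒m<n∨m≡n i<2+n)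
      ; 0<beyond = λ x r′<x → ≰⇒> λ vx≤0 → ≤⇒≯ (r′-largest x vx≤0) r′<x
      }
      where
      r = proj₁ (largestRoot n)
      isRoot = proj₂ (largestRoot n)

      S = sum< n (λ i → M (suc n) i * v r i)

      0<S+ : 0# < S + M (suc n) n * v r n
      0<S+ = +-nonNeg-pos
        (dot-nonNeg (M (suc n)) n λ i i<n → inj₁ (term i (ℕ.m<n⇒m<1+n i<n)))
        (term n ℕ.≤-refl)
        where
        term : ∀ i → i ℕ.< suc n → 0# < M (suc n) i * v r i
        term i i<1+n = *-pos (0<M (suc n) i (ℕ.m<n⇒m<1+n i<1+n)) (0<below isRoot i i<1+n r ≤-refl)

      v[r]<0 : v r (2 ℕ.+ n) < 0#
      v[r]<0 = *-cancelˡ-< (inj₁ (0<a (2 ℕ.+ n))) (pos⇒< 0<S+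
        (trans (solve 4 (λ S u m t → S := u :+ (S :+ m :* con (+ 0)) :- u)
            refl (S + M (suc n) n * v r n) (a (2 ℕ.+ n) * v r (2 ℕ.+ n)) (M (suc n) (suc n)) r)
        (trans (+-congʳ (trans (+-congˡ (+-congˡ (*-congˡ (sym (root isRoot)))))
            (trans (sym (solution r (suc n))) (*-congˡ (root isRoot)))))
          (solve 3 (λ r a u → r :* con (+ 0) :- a :* u := a :* con (+ 0) :- a :* u)
            refl r (a (2 ℕ.+ n)) (v r (2 ℕ.+ n))))))

      root-data = largest-root (lipschitz (2 ℕ.+ n)) (r , inj₁ v[r]<0)
        (proj₁ (eventually-increasing (2 ℕ.+ n)) , λ x vx≤0 → ≮⇒≥ λ R<x →
          ≤⇒≯ vx≤0 (proj₁ (proj₂ (proj₂ (eventually-increasing (2 ℕ.+ n))) x R<x)))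
      r′ = proj₁ root-data
      r′-root : v r′ (2 ℕ.+ n) ≈ 0#
      r′-root = proj₁ (proj₂ root-data)
      r′-largest : ∀ x → v x (2 ℕ.+ n) ≤ 0# → x ≤ r′
      r′-largest = proj₂ (proj₂ root-data)

      r<r′ : r < r′
      r<r′ = [ id
        , (λ r≈r′ → contradiction v[r]<0 (<-irrefl (trans (v-cong (2 ℕ.+ n) r≈r′) r′-root))) ]′
        (r′-largest r (inj₁ v[r]<0))

-- Zeros of the D'Arcais polynomials

module Signed {c ℓ : Level} (A : CommutativeRing c ℓ) where

  open CommutativeRing A
  open PowerSeries A using (sgn)
  open IntegerMultiples A using (solve; _:=_; _:*_; :-_)

  sgn²≈1 : ∀ m → sgn m * sgn m ≈ 1#
  sgn²≈1 zero    = *-identityˡ 1#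
  sgn²≈1 (suc m) = trans (solve 1 (λ s → :- s :* :- s := s :* s) refl (sgn m)) (sgn²≈1 m)

  signed≈0⇒≈0 : ∀ m {y} → sgn m * y ≈ 0# → y ≈ 0#
  signed≈0⇒≈0 m {y} e = trans (sym (*-identityˡ y)) (trans (*-congʳ (sym (sgn²≈1 m)))
    (trans (*-assoc _ _ _) (trans (*-congˡ e) (zeroʳ _))))

  ≈0⇒signed≈0 : ∀ m {y} → y ≈ 0# → sgn m * y ≈ 0#
  ≈0⇒signed≈0 m e = trans (*-congˡ e) (zeroʳ _)

module D'ArcaisZeros {ℓ : Level} (ℝ : CompleteOrderedField ℓ)
  (h : ℕ → CompleteOrderedField.Carrier ℝ)
  (0<h : ∀ n → 1 ℕ.≤ n → CompleteOrderedField._<_ ℝ (CompleteOrderedField.0# ℝ) (h n)) where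

  open CompleteOrderedField ℝ
  open OrderedField ℝ
  open ComplexNumbers ℝ
  open ComplexField ℝ
  open RealContinuity ℝ
  open HessenbergRecurrence ℝ
  open D'Arcais ℝ
  open DualNumbers commutativeRing using (inclusion; inclusion-isRingHomomorphism
    ; proj₁-isRingHomomorphism) renaming (dualRing to ℝ[ε])
  open DualNumbers ℂ-commutativeRing using (infinitesimal²≈0) renaming (dualRing to ℂ[ε]
    ; inclusion to inclusionℂ; inclusion-isRingHomomorphism to inclusionℂ-isRingHomomorphism)
  open DualMap commutativeRing ℂ-commutativeRing ofReal ofReal-isRingHomomorphism
  open PowerSeries commutativeRing using (Series; sum<; sgn)
  open IntegerMultiples commutativeRing using (ι; solve; con; _:=_; _:+_; _:*_; _:-_; :-_)
  private
    module C    = CommutativeRing ℂ-commutativeRing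
    module C[ε] = CommutativeRing ℂ[ε]
    module R[ε] = CommutativeRing ℝ[ε]
    module ℝ[X] = Polynomials rawRing
    module ℂ[X] = Polynomials ℂ-rawRing

  h≉0 : ∀ n → ¬ h (suc n) ≈ 0#
  h≉0 n e = <-irrefl (sym e) (0<h (suc n) (ℕ.s≤s ℕ.z≤n))

  a : Series
  a m = h (suc m)

  M : ℕ → Series
  M m i = ι (DivisorSeries.d (suc m ℕ.∸ i)) * h (suc i)

  0<a : ∀ m → 0# < a m
  0<a m = 0<h (suc m) (ℕ.s≤s ℕ.z≤n)

  0<M : ∀ m i → i ℕ.< suc m → 0# < M m i
  0<M m i _ = *-pos (0<ι (DivisorSeries.0<d (suc m ℕ.∸ i))) (0<a i)

  0≤M : ∀ m i → i ℕ.< suc m → 0# ≤ M m i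
  0≤M m i i<1+m = inj₁ (0<M m i i<1+m)

  module Real (x : Carrier) =
    D'ArcaisRecurrence ℝ commutativeRing id (Identity.isRingHomomorphism rawRing refl) h h≉0 x
  module Complex (x : ℂ) =
    D'ArcaisRecurrence ℝ ℂ-commutativeRing ofReal ofReal-isRingHomomorphism h h≉0 x
  module Dual (x : Carrier × Carrier) =
    D'ArcaisRecurrence ℝ ℝ[ε] inclusion inclusion-isRingHomomorphism h h≉0 x

  v : Carrier → Series
  v = Real.v

  v-cong : ∀ m {x y} → x ≈ y → v x m ≈ v y m
  v-cong m e = *-congˡ (evaluate-cong commutativeRing (map id (P h (suc m))) (-‿cong e))

  v-lipschitz : ∀ m s → LipschitzAt (λ x → v x m) s
  v-lipschitz m s = lipschitz-scale (sgn (suc m))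
    (lipschitz-reflect (evaluate-lipschitz (map id (P h (suc m))) (- s)))

  largest : ∀ k → ∃ λ r → IsLargestRoot {a} {M} 0<a 0<M v Real.initial Real.row v-cong v-lipschitz k r
  largest = largestRoot {a} {M} 0<a 0<M v Real.initial Real.row v-cong v-lipschitz

  v≈0⇒zero : ∀ m {x} → v x m ≈ 0# → ℝ[X].evaluate (map id (P h (suc m))) (- x) ≈ 0#
  v≈0⇒zero m = Signed.signed≈0⇒≈0 commutativeRing (suc m)

  evaluate-ofReal : ∀ q x →
    ofReal (ℝ[X].evaluate (map id q) x) C.≈ ℂ[X].evaluate (map ofReal q) (ofReal x)
  evaluate-ofReal = EvaluationNatural.evaluate-natural commutativeRing commutativeRing
    ℂ-commutativeRing id ofReal ofReal-isRingHomomorphism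

  module _ (x : ℂ) (x≉modulus : ¬ x C.≈ ofReal (modulus x)) where

    private
      u : ℕ → ℂ
      u = Complex.v x

    modulus-dot : ∀ (c : Series) k → (∀ i → i ℕ.< k → 0# ≤ c i) →
      modulus (PowerSeries.sum< ℂ-commutativeRing k (λ i → ofReal (c i) C.* u i))
        ≤ sum< k (λ i → c i * modulus (u i))
    modulus-dot c zero    _   = ≤-reflexive (modulus-ofReal ≤-refl)
    modulus-dot c (suc k) 0≤c = ≤-trans
      (modulus-+ (PowerSeries.sum< ℂ-commutativeRing k (λ i → ofReal (c i) C.* u i))
                 (ofReal (c k) C.* u k))
      (+-mono-≤ (modulus-dot c k (λ i → 0≤c i ∘ ℕ.m<n⇒m<1+n))
        (≤-reflexive (modulus-scale (0≤c k ℕ.≤-refl) (u k))))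
      where
      modulus-scale : ∀ {c} → 0# ≤ c → ∀ z → modulus (ofReal c C.* z) ≈ c * modulus z
      modulus-scale {c} 0≤c z = trans (modulus-* (ofReal c) z) (*-congʳ (modulus-ofReal 0≤c))

    -- The diagonal term is moved to the left before moduli are taken. There |x| < |x - M m m| + M m
    -- m, as M m m > 0; the other terms need only the weak triangle inequality.
    modulus-strict : ∀ m → 0# < modulus (u m) → modulus x * modulus (u m)
      < a (suc m) * modulus (u (suc m)) + sum< (suc m) (λ i → M m i * modulus (u i))
    modulus-strict m 0<um = pos⇒<
      (+-pos-nonNeg
        (*-pos (x<y⇒0<y-x (modulus<modulus-c+c x (0<M m m ℕ.≤-refl) x≉modulus)) 0<um)
        (x≤y⇒0≤y-x shifted≤))
      (solve 7 (λ t μ n X a n′ S → (t :+ μ :- X) :* n :+ (a :* n′ :+ S :- t :* n)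
          := a :* n′ :+ (S :+ μ :* n) :- X :* n) refl
        (modulus (x C.- ofReal (M m m))) (M m m) (modulus (u m)) (modulus x)
        (a (suc m)) (modulus (u (suc m))) (sum< m (λ i → M m i * modulus (u i))))
      where
      S : ℂ
      S = PowerSeries.sum< ℂ-commutativeRing m (λ i → ofReal (M m i) C.* u i)

      module _ where
        open IntegerMultiples ℂ-commutativeRing
          renaming (solve to solveC; _:=_ to _:=C_; _:+_ to _:+C_; _:*_ to _:*C_; _:-_ to _:-C_)
        shifted : (x C.- ofReal (M m m)) C.* u m C.≈ ofReal (a (suc m)) C.* u (suc m) C.+ S
        shifted = C.trans
          (solveC 3 (λ x μ w → (x :-C μ) :*C w :=C x :*C w :-C μ :*C w) C.refl
            x (ofReal (M m m)) (u m))
          (C.trans (C.+-congʳ (Complex.row x m))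
            (solveC 4 (λ a′ S μ w → a′ :+C (S :+C μ :*C w) :-C μ :*C w :=C a′ :+C S) C.refl
              (ofReal (a (suc m)) C.* u (suc m)) S (ofReal (M m m)) (u m)))

      shifted≤ : modulus (x C.- ofReal (M m m)) * modulus (u m)
        ≤ a (suc m) * modulus (u (suc m)) + sum< m (λ i → M m i * modulus (u i))
      shifted≤ = ≤-respˡ
        (trans (modulus-cong (C.sym shifted)) (modulus-* (x C.- ofReal (M m m)) (u m)))
        (≤-trans (modulus-+ (ofReal (a (suc m)) C.* u (suc m)) S)
          (+-mono-≤ (≤-reflexive (trans (modulus-* (ofReal (a (suc m))) (u (suc m)))
                      (*-congʳ (modulus-ofReal (inj₁ (0<a (suc m)))))))
            (modulus-dot (M m) m (λ i i<m → 0≤M m i (ℕ.m<n⇒m<1+n i<m)))))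

    0<modulus-v₀ : 0# < modulus x → 0# < modulus (u 0)
    0<modulus-v₀ 0<x = pos-cancelˡ (inj₁ (0<a 0)) (<-respʳ
      (trans (sym (modulus-cong (Complex.initial x)))
        (trans (modulus-* (ofReal (a 0)) (u 0)) (*-congʳ (modulus-ofReal (inj₁ (0<a 0)))))) 0<x)

    -- The positive real solution at |x| keeps the moduli of the complex one away from 0. Only
    -- nonnegative reals x are excluded, so negative real points are covered as well.
    nonreal-nonzero : ∀ n → 0# < modulus x → (∀ i → i ℕ.< n → 0# < v (modulus x) i) →
      0# ≤ v (modulus x) n → 0# < modulus (u n)
    nonreal-nonzero n 0<x 0<v 0≤v = comparison 0<a 0≤M {N = λ i → modulus (u i)}
      (Real.row (modulus x)) n 0<v 0≤v (0<modulus-v₀ 0<x) (λ m _ → modulus-strict m)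

  module _ (r : Carrier) where

    private
      w : ℕ → Carrier × Carrier
      w = Dual.v (r , 1#)

    proj₁-v : ∀ m → proj₁ (w m) ≈ v r m
    proj₁-v m = *-cong
      (SeriesHomomorphism.sgn-homo ℝ[ε] commutativeRing proj₁ proj₁-isRingHomomorphism (suc m))
      (EvaluationNatural.evaluate-natural commutativeRing ℝ[ε] commutativeRing inclusion proj₁
        proj₁-isRingHomomorphism (P h (suc m)) (- r , - 1#))

    proj₂-dot : ∀ (c : Series) k →
      proj₂ (PowerSeries.sum< ℝ[ε] k (λ i → inclusion (c i) R[ε].* w i))
        ≈ sum< k (λ i → c i * proj₂ (w i))
    proj₂-dot c zero    = refl
    proj₂-dot c (suc k) = +-cong (proj₂-dot c k)
      (trans (+-congˡ (zeroˡ _)) (+-identityʳ _))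

    -- The ε-part of `row` at r + ε is the same recurrence for the derivatives with an additional
    -- `v r m` on the left, and this term gives strictness.
    derivative-strict : ∀ m → 0# < v r m → r * proj₂ (w m)
      < a (suc m) * proj₂ (w (suc m)) + sum< (suc m) (λ i → M m i * proj₂ (w i))
    derivative-strict m 0<vm = pos⇒< 0<vm (trans
      (solve 3 (λ r D v → v := r :* D :+ con (+ 1) :* v :- r :* D) refl r (proj₂ (w m)) (v r m))
      (+-congʳ (trans (+-congˡ (*-congˡ (sym (proj₁-v m))))
        (trans (proj₂ (Dual.row (r , 1#) m))
          (+-cong (trans (+-congˡ (zeroˡ _)) (+-identityʳ _)) (proj₂-dot (M m) (suc m)))))))

    0<derivative-v₀ : 0# < proj₂ (w 0)
    0<derivative-v₀ = pos-cancelˡ (inj₁ (0<a 0)) (<-respʳ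
      (trans (sym (proj₂ (Dual.initial (r , 1#)))) (trans (+-congˡ (zeroˡ _)) (+-identityʳ _))) 0<1)

    0<derivative : ∀ n → (∀ i → i ℕ.< n → 0# < v r i) → 0# ≤ v r n → 0# < proj₂ (w n)
    0<derivative n 0<v 0≤v = comparison 0<a 0≤M {N = λ i → proj₂ (w i)}
      (Real.row r) n 0<v 0≤v 0<derivative-v₀ (λ m m<n _ → derivative-strict m (0<v m m<n))

    -- At -(r + ε) the factor X - α is a multiple of ε, so its square and hence the polynomial
    -- vanish there, including the ε-part. Real parts bring this back from ℂ[ε] to ℝ[ε].
    double-zero⇒derivative≈0 : ∀ m →
      ((ℂ[X].X ℂ[X].⊕ ℂ[X].constant (C.- ofReal (- r))) ℂ[X].^ 2) ℂ[X].∣ map ofReal (P h (suc m)) →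
      proj₂ (w m) ≈ 0#
    double-zero⇒derivative≈0 m (q RawMagmaDefinitions., divides) =
      proj₂ (Signed.≈0⇒signed≈0 ℝ[ε] (suc m) {p[ε]} (proj₁ (proj₁ value≈0) , proj₁ (proj₂ value≈0)))
      where
      z = dualMap (- r , - 1#)
      open Evaluation ℂ-commutativeRing ℂ[ε] inclusionℂ inclusionℂ-isRingHomomorphism z
      p = P h (suc m)
      p[ε] = Polynomials.evaluate R[ε].rawRing (map inclusion p) (- r , - 1#)
      L = ℂ[X].X ℂ[X].⊕ ℂ[X].constant (C.- ofReal (- r))

      proj₁-L : proj₁ (eval L) C.≈ C.0#
      proj₁-L = C.trans (proj₁ (C[ε].trans (eval-⊕ ℂ[X].X (ℂ[X].constant (C.- ofReal (- r))))
        (C[ε].+-cong eval-X (eval-constant (C.- ofReal (- r)))))) (C.-‿inverseʳ (ofReal (- r)))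

      eval≈0 : eval (map ofReal p) C[ε].≈ C[ε].0#
      eval≈0 = C[ε].trans (C[ε].sym (eval-cong (q ℂ[X].⊗ (L ℂ[X].^ 2)) (map ofReal p) divides))
        (C[ε].trans (eval-⊗ q (L ℂ[X].^ 2))
        (C[ε].trans (C[ε].*-congˡ (C[ε].trans (eval-⊗ L (L ℂ[X].^ 1))
           (C[ε].*-congˡ (eval-⊗ L (ℂ[X].constant C.1#)))))
          (infinitesimal²≈0 (eval q) (eval (ℂ[X].constant C.1#)) proj₁-L)))

      value≈0 : dualMap p[ε] C[ε].≈ C[ε].0#
      value≈0 = C[ε].trans
        (EvaluationNatural.evaluate-natural commutativeRing ℝ[ε] ℂ[ε] inclusion dualMap
          dualMap-isRingHomomorphism p (- r , - 1#))
        -- Reaching ℂ[ε] through ℝ[ε] or through ℂ gives definitionally equal coefficients, since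
        -- zero in ℂ is the image of zero in ℝ; only the composite map has to be split.
        (C[ε].trans (C[ε].reflexive (≡.cong (λ l → Polynomials.evaluate C[ε].rawRing l z) (map-∘ p)))
          eval≈0)

  open Zeros ℝ

  module LargestZero (k : ℕ) where

    r : Carrier
    r = proj₁ (largest k)

    open IsLargestRoot (proj₂ (largest k)) public

    n : ℕ
    n = 2 ℕ.+ k

    p = P h n

    α : ℂ
    α = ofReal (- r)

    α-zero : ℂ[X].IsZero (complexify p) α
    α-zero = C.trans (C.sym (evaluate-ofReal p (- r)))
      (v≈0⇒zero (suc k) root , refl)

    modulus-α : modulus α ≈ r
    modulus-α = modulus-unique α (inj₁ 0<root)
      (solve 1 (λ r → r :* r := :- r :* :- r :+ con (+ 0) :* con (+ 0)) refl r)

    0≤v : ∀ {x} → r ≤ x → 0# ≤ v x (suc k)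
    0≤v = [ (λ r<x → inj₁ (0<beyond _ r<x))
          , (λ r≈x → inj₂ (trans (sym root) (v-cong (suc k) r≈x))) ]′

    module _ (β : ℂ) (β-zero : ℂ[X].IsZero (complexify p) β) (β≉α : ¬ β C.≈ α) where

      private
        x = C.- β
        ρ = modulus x

      β≈-x : β C.≈ C.- x
      β≈-x = solve 1 (λ b → b := :- :- b) refl (re β) , solve 1 (λ b → b := :- :- b) refl (im β)

      ¬r≤ρ : ¬ r ≤ ρ
      ¬r≤ρ r≤ρ = <-irrefl (sym modulus≈0) (nonreal-nonzero x x≉ρ (suc k)
          (<-≤-trans 0<root r≤ρ) (λ i i<1+k → 0<below i i<1+k ρ r≤ρ) (0≤v r≤ρ))
        where
        modulus≈0 : modulus (Complex.v x (suc k)) ≈ 0#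
        modulus≈0 = trans (modulus-cong (Signed.≈0⇒signed≈0 ℂ-commutativeRing n
            (C.trans (evaluate-cong ℂ-commutativeRing (complexify p) (C.sym β≈-x)) β-zero)))
          (modulus-ofReal ≤-refl)

        -- Otherwise ρ would be a real root with r ≤ ρ; being largest, r would equal ρ, and β would
        -- be α.
        x≉ρ : ¬ x C.≈ ofReal ρ
        x≉ρ x≈ρ = [ (λ r<ρ → <-irrefl (sym v≈0) (0<beyond ρ r<ρ))
                  , (λ r≈ρ → β≉α (C.trans β≈-ρ (-‿cong (sym r≈ρ) , refl))) ]′ r≤ρ
          where
          β≈-ρ : β C.≈ ofReal (- ρ)
          β≈-ρ = C.trans β≈-x (C.trans (C.-‿cong x≈ρ)
            (refl , solve 0 (:- con (+ 0) := con (+ 0)) refl))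
          v≈0 : v ρ (suc k) ≈ 0#
          v≈0 = Signed.≈0⇒signed≈0 commutativeRing n (proj₁ (C.trans (evaluate-ofReal p (- ρ))
            (C.trans (evaluate-cong ℂ-commutativeRing (complexify p) (C.sym β≈-ρ)) β-zero)))

      modulus-β<α : modulus β < modulus α
      modulus-β<α = <-respˡ (modulus-neg β) (<-respʳ (sym modulus-α) (≰⇒> ¬r≤ρ))

    α-simple : ℂ[X].IsSimpleZero (complexify p) α
    α-simple = PolynomialCoefficients.root⇒∣ ℂ-commutativeRing (complexify p) α-zero , λ L²∣p →
      <-irrefl (sym (double-zero⇒derivative≈0 r (suc k) L²∣p))
        (0<derivative r (suc k) (λ i i<1+k → 0<below i i<1+k r ≤-refl) (0≤v ≤-refl))

theorem2p1 : {ℓ : Level} (ℝ : CompleteOrderedField ℓ) →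
    let open CompleteOrderedField ℝ
        open ComplexNumbers ℝ
        open D'Arcais ℝ
        open Zeros ℝ
        open Polynomials ℂ-rawRing using (IsSimpleZero)
    in
    (h : ℕ → Carrier) →
    (∀ n → 1 ℕ.≤ n → 0# < h n) →
    h 1 ≈ 1# →
    (n : ℕ) → 2 ℕ.≤ n →
    ∃ λ (α : ℂ) →
      IsUniqueZeroOfMaximalModulus (complexify (P h n)) α
      × IsNegativeReal α
      × IsSimpleZero (complexify (P h n)) α
theorem2p1 ℝ h 0<h _ (suc (suc k)) _ = α , (α-zero , modulus-β<α)
  , (CompleteOrderedField.refl ℝ , OrderedField.pos-neg ℝ 0<root) , α-simple
  where open D'ArcaisZeros.LargestZero ℝ h 0<h k
theorem2p1 ℝ h 0<h _ (suc zero) (ℕ.s≤s ())
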